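{- Let $g_1(t) = (2t^2)^{2t^2}+2$, $g_2(t) = (2t^2)^2+1$, and $g(t) = 4(g_1(t))^{g_2(t)}$. For every natural number $t$, if $G$ is a rooted directed path graph and the grid rank of the adjacency matrix of $G$ along the order $\prec$ is at least $2 \cdot g(t)$, then $G$ contains a semi-induced transversal pair of half-graphs $T_t$ or a semi-induced generalized transversal pair of half-graphs $T_{t,2}$.
   Context: A rooted directed path graph $G$ has a tree model $(T,\{P_v : v \in V(G)\})$: $T$ is a rooted tree oriented away from the root (every node reachable from the root), each $P_v$ is a directed path of $T$, and $uw \in E(G)$ iff $V(P_u)\cap V(P_w)\neq\emptyset$. For a node $p$, $V_p=\{u : p \in V(P_u)\}$; the model is minimal if there are no adjacent nodes $p,p'$ with $V_p \subseteq V_{p'}$; a minimal tree model is fixed. Write $p \leq_T p'$ if $p$ is an ancestor of $p'$. For $v\in V(G)$, $\textsf{high}(v)$ and $\textsf{low}(v)$ are the nodes of $P_v$ closest to and furthest from the root. For a node $q$, $T_q$ is the subtree rooted at $q$. The order $\prec_{\mathrm{DFS}}$ on nodes of $T$ is the order in which nodes are processed by a depth-first search, where a node is processed once all other nodes of its subtree are visited; among siblings $x,y$, $T_x$ is explored before $T_y$ if the symmetric difference of $\{\textsf{high}(v) : \textsf{low}(v)\in V(T_x)\}$ and $\{\textsf{high}(v):\textsf{low}(v)\in V(T_y)\}$ has a $\leq_T$-minimum $\textsf{high}(v)$ with $\textsf{low}(v)\in V(T_x)$ (arbitrary otherwise). The total order $\prec$ on $V(G)$ is: $u \prec v$ if $\textsf{low}(u)\prec_{\mathrm{DFS}}\textsf{low}(v)$,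 or $\textsf{low}(u)=\textsf{low}(v)$ and $\textsf{high}(u)$ is a proper ancestor of $\textsf{high}(v)$ (remaining ties broken arbitrarily). A $k$-division of a matrix partitions rows and columns each into $k$ intervals of consecutive rows/columns; it is a rank-$k$ division if every one of the $k^2$ cells has at least $k$ distinct rows or at least $k$ distinct columns; the grid rank is the maximum $k$ admitting a rank-$k$ division. A generalized transversal pair $T_{t,\ell}$ consists of sets $A=\{a_{i,j}\}$, $B_0=\{b^0_{i,j}\},\dots,B_\ell=\{b^\ell_{i,j}\}$, $C=\{c_{i,j}\}$ ($i,j\in[t]$) with $a_{i,j}b^0_{i',j'}$ an edge iff $(i,j)\leq_{\mathrm{lex}}(i',j')$, $b^{k-1}_{i,j}b^k_{i',j'}$ an edge iff $(i,j)=(i',j')$ for $k\in[\ell]$, and $b^\ell_{i,j}c_{i',j'}$ an edge iff $(j,i)\leq_{\mathrm{lex}}(j',i')$; $T_t=T_{t,0}$. It is semi-induced if the graph contains these vertices with exactly these adjacencies between the specified consecutive sets, allowing arbitrary extra edges only between pairs of sets with no predefined edges. -}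

module Defs where

open import Data.Nat using (ℕ; zero; suc; _+_; _*_; _^_; _≤_; _<_)
open import Data.Fin using (Fin; toℕ; fromℕ; inject₁) renaming (zero to fzero; suc to fsuc)
open import Data.Bool using (Bool; true; false)
open import Data.Maybe using (Maybe; just; nothing)
open import Data.Product using (Σ; ∃; ∃-syntax; _×_; _,_)
open import Data.Sum using (_⊎_)
open import Relation.Nullary using (¬_)
open import Relation.Binary.PropositionalEquality using (_≡_; _≢_)
open import Function.Bundles using (_⇔_)
open import Function.Definitions using (Injective)

g₁ : ℕ → ℕ
g₁ t = (2 * (t * t)) ^ (2 * (t * t)) + 2

g₂ : ℕ → ℕ
g₂ t = (2 * (t * t)) ^ 2 + 1

g : ℕ → ℕ
g t = 4 * (g₁ t ^ g₂ t)

record SimpleGraph (n : ℕ) : Set where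
  field
    Adj     : Fin n → Fin n → Bool
    sym     : ∀ u w → Adj u w ≡ Adj w u
    irrefl  : ∀ u → Adj u u ≡ false

data Anc {m : ℕ} (parent : Fin m → Maybe (Fin m)) (p : Fin m) : Fin m → Set where
  here  : Anc parent p p
  there : ∀ {q q'} → parent q ≡ just q' → Anc parent p q' → Anc parent p q

record RootedTree (m : ℕ) : Set where
  field
    root        : Fin m
    parent      : Fin m → Maybe (Fin m)
    root-parent : parent root ≡ nothing
    reachable   : ∀ q → Anc parent root q

  _≤T_ : Fin m → Fin m → Set
  p ≤T q = Anc parent p q

  _<T_ : Fin m → Fin m → Set
  p <T q = Anc parent p q × p ≢ q

  TreeAdj : Fin m → Fin m → Set
  TreeAdj p q = parent p ≡ just q ⊎ parent q ≡ just p

  Siblings : Fin m → Fin m → Set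
  Siblings x y = x ≢ y × Σ (Fin m) (λ z → parent x ≡ just z × parent y ≡ just z)

-- Tree models of a graph.  The directed path P_v (oriented away from the
-- root) is determined by its endpoints high v ≤_T low v; its node set is
-- { x : high v ≤_T x ≤_T low v }.

record TreeModel {n : ℕ} (G : SimpleGraph n) (m : ℕ) : Set where
  field
    tree     : RootedTree m
  open RootedTree tree public
  field
    high     : Fin n → Fin m
    low      : Fin n → Fin m
    high≤low : ∀ v → high v ≤T low v

  InPath : Fin n → Fin m → Set
  InPath v p = high v ≤T p × p ≤T low v

  field
    edges : ∀ u w → u ≢ w →
            (SimpleGraph.Adj G u w ≡ true ⇔ Σ (Fin m) (λ p → InPath u p × InPath w p))

  _⊆V_ : Fin m → Fin m → Set
  p ⊆V p' = ∀ v → InPath v p → InPath v p'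

  Minimal : Set
  Minimal = ∀ p p' → TreeAdj p p' → ¬ (p ⊆V p')

  HighsBelow : Fin m → Fin m → Set
  HighsBelow x z = Σ (Fin n) (λ v → x ≤T low v × high v ≡ z)

  SymDiffMinIn : Fin m → Fin m → Set
  SymDiffMinIn x y =
    Σ (Fin m) (λ z →
      (HighsBelow x z × ¬ HighsBelow y z) ×
      (∀ z' → (HighsBelow x z' × ¬ HighsBelow y z') ⊎ (HighsBelow y z' × ¬ HighsBelow x z')
            → z ≤T z'))

  -- ρ : Fin m → Fin m is the position of each node in ≺_DFS, i.e. a
  -- post-order depth-first search obeying the sibling rule.
  IsDFSOrder : (Fin m → Fin m) → Set
  IsDFSOrder ρ =
    Injective _≡_ _≡_ ρ ×
    -- each subtree T_q is a set of consecutive nodes ending with q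
    ((∀ q x → q ≤T x → toℕ (ρ x) ≤ toℕ (ρ q)) ×
     (∀ q x z → q ≤T x → toℕ (ρ x) ≤ toℕ (ρ z) → toℕ (ρ z) ≤ toℕ (ρ q) → q ≤T z)) ×
    (∀ x y → Siblings x y → SymDiffMinIn x y → toℕ (ρ x) < toℕ (ρ y))

  -- σ : Fin n → Fin n lists V(G) in the order ≺ (σ i is the i-th vertex),
  -- where ≺ is built from ≺_DFS with position function ρ.
  IsVertexOrder : (Fin m → Fin m) → (Fin n → Fin n) → Set
  IsVertexOrder ρ σ =
    Injective _≡_ _≡_ σ ×
    (∀ i j →
       (toℕ (ρ (low (σ i))) < toℕ (ρ (low (σ j))) ⊎
        (low (σ i) ≡ low (σ j) × high (σ i) <T high (σ j)))
       → toℕ i < toℕ j)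

adjMatrix : ∀ {n} → SimpleGraph n → (Fin n → Fin n) → Fin n → Fin n → Bool
adjMatrix G σ i j = SimpleGraph.Adj G (σ i) (σ j)

record IntervalPartition (r k : ℕ) : Set where
  field
    cut       : Fin (suc k) → ℕ
    cut-first : cut fzero ≡ 0
    cut-last  : cut (fromℕ k) ≡ r
    cut-mono  : ∀ (a : Fin k) → cut (inject₁ a) < cut (fsuc a)

  InPart : Fin k → Fin r → Set
  InPart a i = cut (inject₁ a) ≤ toℕ i × toℕ i < cut (fsuc a)

record Division (r c k : ℕ) : Set where
  field
    rows : IntervalPartition r k
    cols : IntervalPartition c k

AtLeastDistinctRows : ∀ {r c} → (Fin r → Fin c → Bool) →
                      (Fin r → Set) → (Fin c → Set) → ℕ → Set
AtLeastDistinctRows {r} {c} M R C k =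
  Σ (Fin k → Fin r) (λ f →
    (∀ a → R (f a)) ×
    (∀ a b → a ≢ b → Σ (Fin c) (λ j → C j × M (f a) j ≢ M (f b) j)))

AtLeastDistinctCols : ∀ {r c} → (Fin r → Fin c → Bool) →
                      (Fin r → Set) → (Fin c → Set) → ℕ → Set
AtLeastDistinctCols {r} {c} M R C k =
  Σ (Fin k → Fin c) (λ f →
    (∀ a → C (f a)) ×
    (∀ a b → a ≢ b → Σ (Fin r) (λ i → R i × M i (f a) ≢ M i (f b))))

IsRankDivision : ∀ {r c k} → (Fin r → Fin c → Bool) → Division r c k → Set
IsRankDivision {r} {c} {k} M D =
  ∀ (a b : Fin k) →
    AtLeastDistinctRows M (IntervalPartition.InPart (Division.rows D) a)
                          (IntervalPartition.InPart (Division.cols D) b) k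
    ⊎
    AtLeastDistinctCols M (IntervalPartition.InPart (Division.rows D) a)
                          (IntervalPartition.InPart (Division.cols D) b) k

HasRankDivision : ∀ {r c} → (Fin r → Fin c → Bool) → ℕ → Set
HasRankDivision {r} {c} M k = Σ (Division r c k) (IsRankDivision M)

-- grid rank of M is at least N  (the maximum k admitting a rank-k
-- division is ≥ N)
GridRankAtLeast : ∀ {r c} → (Fin r → Fin c → Bool) → ℕ → Set
GridRankAtLeast M N = Σ ℕ (λ k → N ≤ k × HasRankDivision M k)

_≤lex_ : ∀ {t} → Fin t × Fin t → Fin t × Fin t → Set
(i , j) ≤lex (i' , j') = toℕ i < toℕ i' ⊎ (i ≡ i' × toℕ j ≤ toℕ j')

data Label (t ℓ : ℕ) : Set where
  A : Fin t → Fin t → Label t ℓ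
  B : Fin (suc ℓ) → Fin t → Fin t → Label t ℓ
  C : Fin t → Fin t → Label t ℓ

-- G contains a semi-induced T_{t,ℓ}: distinct vertices with exactly the
-- prescribed adjacencies between A–B⁰, B^{k-1}–B^k (k ∈ [ℓ]) and B^ℓ–C;
-- all other pairs are unconstrained.
record SemiInducedGTP {n : ℕ} (G : SimpleGraph n) (t ℓ : ℕ) : Set where
  open SimpleGraph G
  field
    vtx   : Label t ℓ → Fin n
    inj   : Injective _≡_ _≡_ vtx
    adjAB : ∀ i j i' j' →
            (Adj (vtx (A i j)) (vtx (B fzero i' j')) ≡ true ⇔ (i , j) ≤lex (i' , j'))
    adjBB : ∀ (k : Fin ℓ) i j i' j' →
            (Adj (vtx (B (inject₁ k) i j)) (vtx (B (fsuc k) i' j')) ≡ true ⇔ (i ≡ i' × j ≡ j'))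
    adjBC : ∀ i j i' j' →
            (Adj (vtx (B (fromℕ ℓ) i j)) (vtx (C i' j')) ≡ true ⇔ (j , i) ≤lex (j' , i'))

{-# OPTIONS --safe #-}
module Submission where

open import Defs
open import Data.Nat using (ℕ; _*_)
open import Data.Fin using (Fin)
open import Data.Sum using (_⊎_)

open import Data.Bool using (Bool; true; false)
open import Data.Empty using (⊥; ⊥-elim)
open import Data.Fin
  using (zero; suc; toℕ; fromℕ; fromℕ<; inject₁; inject≤; combine; remQuot; opposite; _≟_)
open import Data.Fin.Properties
  using (toℕ-injective; toℕ<n; toℕ-fromℕ<; toℕ-inject₁; inject≤-injective; any?; ¬∀⟶∃¬;
         toℕ-combine; combine-monoˡ-<; combine-injective; remQuot-combine;
         combine-remQuot; opposite-prop; opposite-involutive)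
open import Data.Maybe using (just)
import Data.Maybe.Properties as Maybeₚ
open import Data.Nat
  using (zero; suc; _+_; _^_; _∸_; _≤_; _<_; z≤n; s≤s; _<?_; NonZero; >-nonZero)
open import Data.Nat.Properties hiding (_≟_)
open import Algebra.Properties.CommutativeSemigroup *-commutativeSemigroup using (x∙yz≈y∙xz)
open import Data.Nat.Solver using (module +-*-Solver)
open import Data.Product using (Σ; ∃; _×_; _,_; proj₁; proj₂; swap)
open import Data.Sum using (inj₁; inj₂) renaming (swap to ⊎-swap)
open import Function using (_∘_; id)
open import Function.Bundles using (_⇔_; mk⇔; Equivalence)
open import Function.Definitions using (Injective)
open import Relation.Binary.Definitions using (tri<; tri≈; tri>)
open import Relation.Binary.PropositionalEquality
  using (_≡_; _≢_; refl; sym; trans; cong; cong₂; subst; subst₂)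
open import Relation.Nullary using (¬_; Dec; yes; no; contradiction)
open import Relation.Nullary.Decidable
  using (map′; _×-dec_; _→-dec_; ¬?; decidable-stable)
import Function.Properties.Equivalence as ⇔
open Equivalence using (to; from)

-- If all vertices of X precede all vertices of Y, then relative to a vertex e
-- between them every adjacency across X and Y is decided by the nodes
-- γ i = lca (low i, low e), which move monotonically along the root path of low e.
-- On suitable halves of X and Y the condition is just high w ≤ γ u, so a rank
-- division yields a grid: windows on a root path, and in each of many
-- consecutive parts of the order a vertex w with high w in each window and low w below
-- all of them.  Minimality supplies, for every node of the path, vertices
-- leaving the path exactly there, and these see the order of the highs.
--
-- Below the windows one descends in T.  Either many nested nodes x each
-- separate some w, and vertices with high end x see the second order (T_{t,0}),
-- or many parts lie below pairwise different children of one node.  In the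
-- latter case the sibling rule is lexicographic, and halving the parts finds
-- siblings carrying strictly nested highs; vertices starting at these siblings
-- match the w with the vertices realising these highs (T_{t,2}).

-- Number of sibling-disjoint parts from which k nested highs can be chosen.
siblingBound : ℕ → ℕ
siblingBound zero    = 0
siblingBound (suc k) = suc (suc (siblingBound k + siblingBound k))

-- Number of consecutive parts in which the descent finds `k` nested nodes or a sibling pattern of
-- size `D`. The recursion counts a first and a last part, two spare parts, and `siblingBound D`
-- blocks, each with a start part, two test parts and the parts of the next level.
descentBound : ℕ → ℕ → ℕ
descentBound D zero    = 0
descentBound D (suc k) = 4 + siblingBound D * (3 + descentBound D k)

<-≢⇒injective : ∀ {k} {X : Set} {x : Fin k → X} →
                (∀ i j → toℕ i < toℕ j → x i ≢ x j) → Injective _≡_ _≡_ x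
<-≢⇒injective distinct {i} {j} e with <-cmp (toℕ i) (toℕ j)
... | tri< i<j _ _ = ⊥-elim (distinct i j i<j e)
... | tri≈ _ i≡j _ = toℕ-injective i≡j
... | tri> _ _ j<i = ⊥-elim (distinct j i j<i (sym e))

-- Ancestor order, branches and lowest common ancestors in a rooted tree.

module RootedTreeProperties {m : ℕ} (T : RootedTree m) where
  open RootedTree T

  abstract
    parent-unique : ∀ {q x y} → parent q ≡ just x → parent q ≡ just y → x ≡ y
    parent-unique e e' = Maybeₚ.just-injective (trans (sym e) e')

    root-no-parent : ∀ {x} → parent root ≢ just x
    root-no-parent e with trans (sym root-parent) e
    ... | ()

    ≤T-trans : ∀ {p q r} → p ≤T q → q ≤T r → p ≤T r
    ≤T-trans pq here        = pq
    ≤T-trans pq (there e d) = there e (≤T-trans pq d)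

    ≤T-reflexive : ∀ {p q} → p ≡ q → p ≤T q
    ≤T-reflexive refl = here

    parent⇒≤T : ∀ {x y} → parent x ≡ just y → y ≤T x
    parent⇒≤T e = there e here

    height : ∀ {p q} → Anc parent p q → ℕ
    height here        = 0
    height (there _ d) = suc (height d)

    -- Each node has at most one parent and the root none, so a derivation from the root leaves no
    -- choice. This makes `depth` independent of the derivation and, through `depth-parent`,
    -- excludes cycles of `parent`.
    height-unique : ∀ {q} (d d' : Anc parent root q) → height d ≡ height d'
    height-unique here        here         = refl
    height-unique here        (there e _)  = ⊥-elim (root-no-parent e)
    height-unique (there e _) here         = ⊥-elim (root-no-parent e)
    height-unique (there e d) (there e' d') with parent-unique e e'
    ... | refl = cong suc (height-unique d d')

    depth : Fin m → ℕ
    depth q = height (reachable q)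

    depth-parent : ∀ {x y} → parent x ≡ just y → depth x ≡ suc (depth y)
    depth-parent {x} {y} e = height-unique (reachable x) (there e (reachable y))

    depth-mono : ∀ {p q} → p ≤T q → depth p ≤ depth q
    depth-mono here        = ≤-refl
    depth-mono (there e d) =
      ≤-trans (depth-mono d) (≤-trans (n≤1+n _) (≤-reflexive (sym (depth-parent e))))

    child≰parent : ∀ {x q} → parent x ≡ just q → ¬ (x ≤T q)
    child≰parent e x≤q = 1+n≰n (≤-trans (≤-reflexive (sym (depth-parent e))) (depth-mono x≤q))

    ≤T-antisym : ∀ {p q} → p ≤T q → q ≤T p → p ≡ q
    ≤T-antisym here        _  = refl
    ≤T-antisym (there e d) qp = ⊥-elim (child≰parent e (≤T-trans qp d))

    comparable : ∀ {p q r} → p ≤T r → q ≤T r → p ≤T q ⊎ q ≤T p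
    comparable here        qr   = inj₂ qr
    comparable pr@(there _ _) here = inj₁ pr
    comparable (there e d) (there e' d') with parent-unique e e'
    ... | refl = comparable d d'

    -- Decided along the derivation of `reachable q`, since climbing by `parent` alone is not
    -- structurally recursive; `lca` and `topmost` recurse in the same way.
    _≤T?_ : ∀ p q → Dec (p ≤T q)
    p ≤T? q = go (reachable q)
      where
      go : ∀ {q} → Anc parent root q → Dec (p ≤T q)
      go {q} d with p ≟ q
      ... | yes refl = yes here
      go here | no p≢q =
        no λ { here → p≢q refl ; (there e _) → root-no-parent e }
      go (there e d) | no p≢q =
        map′ (there e)
             (λ { here → ⊥-elim (p≢q refl)
                ; (there e' d') → subst (p ≤T_) (parent-unique e' e) d' })
             (go d)

    ≤T-parent : ∀ {p x y} → p ≤T x → p ≢ x → parent x ≡ just y → p ≤T y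
    ≤T-parent here         p≢x _ = ⊥-elim (p≢x refl)
    ≤T-parent (there e d) _   e' = subst (_ ≤T_) (parent-unique e e') d

    <T-≤T-trans : ∀ {p q r} → p <T q → q ≤T r → p <T r
    <T-≤T-trans (pq , p≢q) qr = ≤T-trans pq qr , λ { refl → p≢q (≤T-antisym pq qr) }

    ≤T-<T-trans : ∀ {p q r} → p ≤T q → q <T r → p <T r
    ≤T-<T-trans pq (qr , q≢r) = ≤T-trans pq qr , λ { refl → q≢r (≤T-antisym qr pq) }

    <T⇒≱T : ∀ {p q} → p <T q → ¬ (q ≤T p)
    <T⇒≱T (pq , p≢q) qp = p≢q (≤T-antisym pq qp)

    child-towards : ∀ {q v} → q ≤T v → q ≢ v → Σ (Fin m) λ c → parent c ≡ just q × c ≤T v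
    child-towards here q≢v = ⊥-elim (q≢v refl)
    child-towards {q} {v} (there {q' = q'} e d) _ with q ≟ q'
    ... | yes refl = v , e , here
    ... | no q≢q'  with child-towards d q≢q'
    ...   | c , ec , c≤q' = c , ec , there e c≤q'

    -- Junk value q unless q is a proper ancestor of v.
    branch : Fin m → Fin m → Fin m
    branch q v with any? (λ c → Maybeₚ.≡-dec _≟_ (parent c) (just q) ×-dec (c ≤T? v))
    ... | yes (c , _) = c
    ... | no _        = q

    branch-spec : ∀ {q v} → q ≤T v → q ≢ v → parent (branch q v) ≡ just q × branch q v ≤T v
    branch-spec {q} {v} q≤v q≢v
      with any? (λ c → Maybeₚ.≡-dec _≟_ (parent c) (just q) ×-dec (c ≤T? v))
    ... | yes (_ , spec) = spec
    ... | no none        = ⊥-elim (none (child-towards q≤v q≢v))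

    siblings-disjoint : ∀ {x y q v} → parent x ≡ just q → parent y ≡ just q →
                        x ≤T v → y ≤T v → x ≡ y
    siblings-disjoint {x} {y} ex ey x≤v y≤v with x ≟ y
    ... | yes x≡y = x≡y
    ... | no x≢y with comparable x≤v y≤v
    ...   | inj₁ x≤y = ⊥-elim (child≰parent ex (≤T-parent x≤y x≢y ey))
    ...   | inj₂ y≤x = ⊥-elim (child≰parent ey (≤T-parent y≤x (x≢y ∘ sym) ex))

    lca : ∀ p q → Σ (Fin m) λ l → l ≤T p × l ≤T q × (∀ z → z ≤T p → z ≤T q → z ≤T l)
    lca p q = go (reachable p)
      where
      go : ∀ {p} → Anc parent root p →
           Σ (Fin m) λ l → l ≤T p × l ≤T q × (∀ z → z ≤T p → z ≤T q → z ≤T l)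
      go {p} d with p ≤T? q
      ... | yes p≤q = p , here , p≤q , λ _ z≤p _ → z≤p
      go here        | no p≰q = ⊥-elim (p≰q (reachable q))
      go (there e d) | no p≰q with go d
      ... | l , l≤p , l≤q , greatest =
        l , there e l≤p , l≤q ,
        λ z z≤p z≤q → greatest z (≤T-parent z≤p (λ { refl → p≰q z≤q }) e) z≤q

    topmost : ∀ {Q : Fin m → Set} → (∀ z → Dec (Q z)) → ∀ z →
              (Σ (Fin m) λ z' → z' ≤T z × Q z' × (∀ y → y ≤T z' → Q y → y ≡ z'))
              ⊎ (∀ y → y ≤T z → ¬ Q y)
    topmost {Q} Q? z = go (reachable z)
      where
      go : ∀ {z} → Anc parent root z →
           (Σ (Fin m) λ z' → z' ≤T z × Q z' × (∀ y → y ≤T z' → Q y → y ≡ z'))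
           ⊎ (∀ y → y ≤T z → ¬ Q y)
      go here with Q? root
      ... | yes qr = inj₁ (root , here , qr , λ y y≤ _ → ≤T-antisym y≤ (reachable y))
      ... | no ¬qr = inj₂ λ y y≤ qy → ¬qr (subst Q (≤T-antisym y≤ (reachable y)) qy)
      go {z} (there e d) with go d
      ... | inj₁ (z' , z'≤ , qz' , least) = inj₁ (z' , there e z'≤ , qz' , least)
      ... | inj₂ none with Q? z
      ...   | yes qz = inj₁ (z , here , qz , least)
        where
        least : ∀ y → y ≤T z → Q y → y ≡ z
        least y y≤z qy with y ≟ z
        ... | yes y≡z = y≡z
        ... | no y≢z  = ⊥-elim (none y (≤T-parent y≤z y≢z e) qy)
      ...   | no ¬qz = inj₂ none'
        where
        none' : ∀ y → y ≤T z → ¬ Q y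
        none' y y≤z qy with y ≟ z
        ... | yes refl = ¬qz qy
        ... | no y≢z   = none y (≤T-parent y≤z y≢z e) qy

-- Vertices supplied by minimality of the tree model.

module MinimalModel {n m : ℕ} {G : SimpleGraph n} (M : TreeModel G m)
                    (minimal : TreeModel.Minimal M) where
  open SimpleGraph G using (Adj)
  open TreeModel M
  open RootedTreeProperties tree

  abstract
    inPath? : ∀ v p → Dec (InPath v p)
    inPath? v p = (high v ≤T? p) ×-dec (p ≤T? low v)

    highsBelow? : ∀ x z → Dec (HighsBelow x z)
    highsBelow? x z = any? (λ v → (x ≤T? low v) ×-dec (high v ≟ z))

    distinguished : ∀ {p p'} → TreeAdj p p' → Σ (Fin n) λ v → InPath v p × ¬ InPath v p'
    distinguished {p} {p'} adj
      with ¬∀⟶∃¬ n _ (λ v → inPath? v p →-dec inPath? v p') (minimal p p' adj)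
    ... | v , ¬imp =
      v , decidable-stable (inPath? v p) (λ ¬p → ¬imp (⊥-elim ∘ ¬p)) , λ p' → ¬imp (λ _ → p')

    -- Minimality at `x` and its parent yields a path that contains `x` but not the parent, and such
    -- a path can only begin at `x`.
    starting : ∀ {x y} → parent x ≡ just y → Σ (Fin n) λ v → high v ≡ x
    starting {x} e with distinguished (inj₁ e)
    ... | v , (h≤x , x≤l) , ¬y with high v ≟ x
    ...   | yes h≡x = v , h≡x
    ...   | no h≢x  = ⊥-elim (¬y (≤T-parent h≤x h≢x e , ≤T-trans (parent⇒≤T e) x≤l))

  -- For `z` properly above `p`, this is the node where the path of `v` branches off the root path
  -- of `p` or stops.
  Leaves : Fin m → Fin m → Fin n → Set
  Leaves z p v = InPath v z × (∀ y → y ≤T p → InPath v y → y ≤T z)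

  abstract
    -- Minimality is applied to `z` and its child towards `p`: some path contains `z` and misses
    -- that child, hence also everything from the child down to `p`.
    leaving : ∀ {z p} → z <T p → ∃ (Leaves z p)
    leaving {z} {p} (z≤p , z≢p) with child-towards z≤p z≢p
    ... | c , e , c≤p with distinguished (inj₂ e)
    ...   | v , vz , ¬vc = v , vz , deepest
      where
      deepest : ∀ y → y ≤T p → InPath v y → y ≤T z
      deepest y y≤p vy with y ≟ c
      ... | yes refl = ⊥-elim (¬vc vy)
      ... | no y≢c with comparable y≤p c≤p
      ...   | inj₁ y≤c = ≤T-parent y≤c y≢c e
      ...   | inj₂ c≤y =
        ⊥-elim (¬vc (≤T-trans (proj₁ vz) (parent⇒≤T e) , ≤T-trans c≤y (proj₂ vy)))

    Leaves-¬InPath : ∀ {z p v} → z <T p → Leaves z p v → ¬ InPath v p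
    Leaves-¬InPath z<p (_ , deepest) vp = <T⇒≱T z<p (deepest _ here vp)

    Leaves-unique : ∀ {y z p v} → y ≤T p → z ≤T p → Leaves y p v → Leaves z p v → y ≡ z
    Leaves-unique y≤p z≤p (vy , dy) (vz , dz) = ≤T-antisym (dz _ y≤p vy) (dy _ z≤p vz)

    -- The path of `w` covers the stretch from `high w` to `p`, so it meets that of `v` on this
    -- stretch exactly when it starts at or above `z`. They cannot meet below `p`, since the path of
    -- `v` would then pass through `p`.
    leaving-adj : ∀ {z p v w} → z <T p → Leaves z p v → InPath w p →
                  Adj v w ≡ true ⇔ high w ≤T z
    leaving-adj {z} {p} {v} {w} z<p lv@(vz , deepest) wp@(hw≤p , p≤lw) =
      mk⇔ (λ a → meet⇒ (to (edges v w v≢w) a))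
          (λ hw≤z → from (edges v w v≢w) (z , vz , hw≤z , ≤T-trans (proj₁ z<p) p≤lw))
      where
      v≢w : v ≢ w
      v≢w refl = Leaves-¬InPath z<p lv wp
      meet⇒ : Σ (Fin m) (λ y → InPath v y × InPath w y) → high w ≤T z
      meet⇒ (y , vy , hw≤y , y≤lw) with comparable y≤lw p≤lw
      ... | inj₁ y≤p = ≤T-trans hw≤y (deepest y y≤p vy)
      ... | inj₂ p≤y = ⊥-elim (Leaves-¬InPath z<p lv
              (≤T-trans (proj₁ vz) (proj₁ z<p) , ≤T-trans p≤y (proj₂ vy)))

    start-adj : ∀ {x v w} → high v ≡ x → v ≢ w → high w ≤T x → Adj v w ≡ true ⇔ x ≤T low w
    start-adj {v = v} {w} refl v≢w hw≤x =
      mk⇔ (λ a → let (y , (x≤y , _) , (_ , y≤lw)) = to (edges v w v≢w) a in ≤T-trans x≤y y≤lw)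
          (λ x≤lw → from (edges v w v≢w) (high v , (here , high≤low v) , (hw≤x , x≤lw)))

-- The depth-first order and grids of windows on a root path.

module DFSOrder {n m : ℕ} {G : SimpleGraph n} (M : TreeModel G m)
                (minimal : TreeModel.Minimal M)
                (ρ : Fin m → Fin m) (dfs : TreeModel.IsDFSOrder M ρ) where
  open TreeModel M
  open RootedTreeProperties tree
  open MinimalModel M minimal

  pos : Fin m → ℕ
  pos x = toℕ (ρ x)

  pos-injective : ∀ {x y} → pos x ≡ pos y → x ≡ y
  pos-injective e = proj₁ dfs (toℕ-injective e)

  pos-descendant : ∀ {q x} → q ≤T x → pos x ≤ pos q
  pos-descendant = proj₁ (proj₁ (proj₂ dfs)) _ _

  pos-convex : ∀ {q x y} z → q ≤T x → q ≤T y → pos x ≤ pos z → pos z ≤ pos y → q ≤T z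
  pos-convex z q≤x q≤y xz zy =
    proj₂ (proj₁ (proj₂ dfs)) _ _ z q≤x xz (≤-trans zy (pos-descendant q≤y))

  pos-ancestor : ∀ {q x y} → q ≤T x → pos x ≤ pos y → pos y ≤ pos q → q ≤T y
  pos-ancestor = proj₂ (proj₁ (proj₂ dfs)) _ _ _

  abstract
    -- The sibling rule is a lexicographic one: as long as two children x, y of
    -- q agree on P, the earlier child x has the higher next element.
    earlier-sibling-higher :
      ∀ {q x y} → parent x ≡ just q → parent y ≡ just q → pos x < pos y →
      ∀ {P : Fin m → Set} → (∀ z → Dec (P z)) →
      (∀ z → P z → HighsBelow x z → HighsBelow y z) →
      (∀ z → P z → HighsBelow y z → HighsBelow x z) →
      ∀ {z} → z ≤T q → HighsBelow y z → ¬ P z →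
      Σ (Fin m) λ z' → z' ≤T z × HighsBelow x z' × ¬ P z'
    earlier-sibling-higher {q} {x} {y} ex ey x<y {P} P? xy yx {z} z≤q yz ¬pz
      with topmost (λ u → highsBelow? y u ×-dec ¬? (P? u)) z
    ... | inj₂ none = ⊥-elim (none z here (yz , ¬pz))
    ... | inj₁ (z₀ , z₀≤z , (yz₀ , ¬pz₀) , least)
      with topmost (λ u → highsBelow? x u ×-dec ¬? (P? u)) z₀
    ...   | inj₁ (z' , z'≤z₀ , (xz' , ¬pz') , _) = z' , ≤T-trans z'≤z₀ z₀≤z , xz' , ¬pz'
    -- Otherwise `z₀` is the minimum of the symmetric difference and belongs to `y`, so the sibling
    -- rule would place `y` before `x`.
    ...   | inj₂ none = ⊥-elim (<-asym x<y
              (proj₂ (proj₂ dfs) y x ((λ { refl → <-irrefl refl x<y }) , q , ey , ex)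
                (z₀ , (yz₀ , λ xz₀ → none z₀ here (xz₀ , ¬pz₀)) , minimum)))
      where
      z₀≤q : z₀ ≤T q
      z₀≤q = ≤T-trans z₀≤z z≤q

      -- Both nodes lie on one root path. A `u` properly above `z₀` is excluded by agreement if
      -- `P u` holds, and otherwise by the choice of `z₀` or by `none`.
      minimum : ∀ u → (HighsBelow y u × ¬ HighsBelow x u) ⊎ (HighsBelow x u × ¬ HighsBelow y u) →
                z₀ ≤T u
      minimum u (inj₁ (yu@(v , y≤v , refl) , ¬xu))
        with comparable (≤T-trans z₀≤q (≤T-trans (parent⇒≤T ey) y≤v)) (high≤low v)
      ... | inj₁ z₀≤u = z₀≤u
      ... | inj₂ u≤z₀ with P? u
      ...   | yes pu = ⊥-elim (¬xu (yx u pu yu))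
      ...   | no ¬pu = subst (z₀ ≤T_) (sym (least u u≤z₀ (yu , ¬pu))) here
      minimum u (inj₂ (xu@(v , x≤v , refl) , ¬yu))
        with comparable (≤T-trans z₀≤q (≤T-trans (parent⇒≤T ex) x≤v)) (high≤low v)
      ... | inj₁ z₀≤u = z₀≤u
      ... | inj₂ u≤z₀ with P? u
      ...   | yes pu = ⊥-elim (¬yu (xy u pu xu))
      ...   | no ¬pu = ⊥-elim (none u u≤z₀ (xu , ¬pu))

  -- The nodes `s a` climb the root path of `base`; window `a` reaches from `s a` up to, but
  -- excluding, `s (suc a)`. The vertex `w a b` stands for window `a` and part `b`. The last two
  -- fields are all that is kept of the vertex order, between different parts only.
  record Grid (W N : ℕ) : Set where
    field
      base      : Fin m
      s         : ℕ → Fin m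
      w         : ℕ → ℕ → Fin n
      s₀<base   : s 0 <T base
      window    : ∀ {a b} → a < W → b < N →
                  s (suc a) <T high (w a b) × high (w a b) ≤T s a
      base≤low  : ∀ {a b} → a < W → b < N → base ≤T low (w a b)
      low-order : ∀ {a b a' b'} → a < W → a' < W → b < b' → b' < N →
                  pos (low (w a b)) ≤ pos (low (w a' b'))
      low-tie   : ∀ {a b a' b'} → a < W → a' < W → b < b' → b' < N →
                  low (w a b) ≡ low (w a' b') → ¬ (high (w a' b') <T high (w a b))

  module GridProperties {D N : ℕ} (0<D : 0 < D) (0<N : 0 < N) (Γ : Grid (D + D) N) where
    open Grid Γ public

    s-anti : ∀ {a a'} → a ≤ a' → a' ≤ D + D → s a' ≤T s a
    s-anti {zero} {zero} _ _ = here
    s-anti {a} {suc a'} a≤ a'< with m≤n⇒m<n∨m≡n a≤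
    ... | inj₂ refl = here
    ... | inj₁ (s≤s a≤a') =
      let (lo , hi) = window a'< 0<N
      in ≤T-trans (proj₁ lo) (≤T-trans hi (s-anti a≤a' (<⇒≤ a'<)))

    s<base : ∀ {a} → a ≤ D + D → s a <T base
    s<base a≤ = ≤T-<T-trans (s-anti z≤n a≤) s₀<base

    high≤base : ∀ {a b} → a < D + D → b < N → high (w a b) ≤T base
    high≤base a< b< = ≤T-trans (proj₂ (window a< b<)) (proj₁ (s<base (<⇒≤ a<)))

    window-≤T : ∀ {a a' b} → a < D + D → a' < D + D → b < N →
                high (w a b) ≤T s a' ⇔ a' ≤ a
    window-≤T {a} {a'} a< a'< b< =
      mk⇔ (λ h≤ → ≮⇒≥ λ a<a' →
             <T⇒≱T (proj₁ (window a< b<)) (≤T-trans h≤ (s-anti a<a' (<⇒≤ a'<))))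
          (λ a'≤a → ≤T-trans (proj₂ (window a< b<)) (s-anti a'≤a (<⇒≤ a<)))

    -- Strictly nested highs carried by pairwise different siblings.

    module SiblingParts
      {q : Fin m} (base≤q : base ≤T q) {K : ℕ} (f : ℕ → ℕ) (f<N : ∀ {b} → b < K → f b < N)
      (ch : ℕ → ℕ → Fin m)
      (ch-parent : ∀ {a b} → a < D + D → b < K → parent (ch a b) ≡ just q)
      (ch≤low : ∀ {a b} → a < D + D → b < K → ch a b ≤T low (w a (f b)))
      (ch-order : ∀ {a b a' b'} → a < D + D → a' < D + D → b < b' → b' < K →
                  pos (ch a b) < pos (ch a' b'))
      where

      private
        high-below : ∀ {a b} → a < D + D → b < K → HighsBelow (ch a b) (high (w a (f b)))
        high-below a< b< = _ , ch≤low a< b< , refl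

      Agree : (Fin m → Set) → ℕ → ℕ → Set
      Agree P o c = ∀ {a b a' b'} → a < D + D → a' < D + D →
                    o ≤ b → b < o + c → o ≤ b' → b' < o + c →
                    ∀ z → P z → HighsBelow (ch a b) z → HighsBelow (ch a' b') z

      -- In the recursion `P` holds the nodes at or above the highs already used. Staying at or
      -- above `s D` keeps the new highs apart from the first `D` windows, whose vertices `w` enter
      -- the sibling pattern.
      record Choice (k : ℕ) (col : Fin k → ℕ) (o c : ℕ) (P : Fin m → Set) : Set where
        field
          b     : Fin k → ℕ
          y     : Fin k → Fin n
          o≤b   : ∀ i → o ≤ b i
          b<    : ∀ i → b i < o + c
          ch≤y  : ∀ i → ch (col i) (b i) ≤T low (y i)
          y∉P   : ∀ i → ¬ P (high (y i))
          y≤s   : ∀ i → high (y i) ≤T s D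
          b-mono : ∀ i j → toℕ i < toℕ j → b i < b j
          y-mono : ∀ i j → toℕ i < toℕ j → high (y i) <T high (y j)

      -- The bound `s (k + D)` leaves the windows `D` to `D + k - 1` outside `P`, one for each
      -- choice still to be made.
      Choosable : ℕ → Set₁
      Choosable k =
        ∀ (col : Fin k → ℕ) → (∀ i → col i < D + D) → k ≤ D →
        ∀ o → o + siblingBound k ≤ K →
        ∀ (P : Fin m → Set) → (∀ z → Dec (P z)) →
        (∀ {z z'} → z' ≤T z → P z → P z') →
        (∀ z → P z → z ≤T s (k + D)) →
        Agree P o (siblingBound k) → Choice k col o (siblingBound k) P

      -- The first child carries a topmost high `δ` outside `P`, which becomes the next choice. A
      -- middle child decides whether `δ` is shared by all children between the first and itself or
      -- absent from all children after it; that half agrees up to `δ` and is treated recursively.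
      choose-suc : ∀ {k} → Choosable k → Choosable (suc k)
      choose-suc {k} choose-k col col< k<D o o+≤K P P? P-down P-bound agree = outcome
        where
        c c' mid : ℕ
        c  = siblingBound k
        c' = siblingBound (suc k)
        -- The part `o`, a half of `c` parts, the part `mid` and another half of `c` parts make up
        -- `c'`.
        mid = o + suc c

        wd< : k + D < D + D
        wd< = +-monoˡ-< D k<D

        o<mid : o < mid
        o<mid = m<m+n o (s≤s z≤n)

        mid<end : mid < o + c'
        mid<end = +-monoʳ-< o (s≤s (s≤s (m≤m+n c c)))

        o<end : o < o + c'
        o<end = <-trans o<mid mid<end

        x₀ xm : Fin m
        x₀ = ch (col zero) o
        -- Column `k + D` supplies a high that lies outside `P` and still at or above `s D`.
        xm = ch (k + D) mid

        <K : ∀ {b} → b < o + c' → b < K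
        <K b< = <-≤-trans b< o+≤K

        step : ∀ {a b a' b'} → a < D + D → a' < D + D → o ≤ b → b < b' → b' < o + c' →
               ∀ {z} → z ≤T q → HighsBelow (ch a' b') z → ¬ P z →
               Σ (Fin m) λ z' → z' ≤T z × HighsBelow (ch a b) z' × ¬ P z'
        step a< a'< o≤b b<b' b'< =
          earlier-sibling-higher (ch-parent a< (<K b<)) (ch-parent a'< (<K b'<))
            (ch-order a< a'< b<b' (<K b'<)) P?
            (agree a< a'< o≤b b< o≤b' b'<) (agree a'< a< o≤b' b'< o≤b b<)
          where
          b<   = <-trans b<b' b'<
          o≤b' = ≤-trans o≤b (<⇒≤ b<b')

        sD≤q : s D ≤T q
        sD≤q = ≤T-trans (proj₁ (s<base (m≤m+n D D))) base≤q

        z₁ : Fin m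
        z₁ = high (w (k + D) (f mid))

        z₁-window : s (suc k + D) <T z₁ × z₁ ≤T s (k + D)
        z₁-window = window wd< (f<N (<K mid<end))

        z₁≤sD : z₁ ≤T s D
        z₁≤sD = ≤T-trans (proj₂ z₁-window) (s-anti (m≤n+m D k) (<⇒≤ wd<))

        ¬Pz₁ : ¬ P z₁
        ¬Pz₁ pz = <T⇒≱T (proj₁ z₁-window) (P-bound z₁ pz)

        first : Σ (Fin m) λ z' → z' ≤T z₁ × (HighsBelow x₀ z' × ¬ P z') ×
                (∀ y → y ≤T z' → HighsBelow x₀ y × ¬ P y → y ≡ z')
        first with step (col< zero) wd< ≤-refl o<mid mid<end (≤T-trans z₁≤sD sD≤q)
                        (high-below wd< (<K mid<end)) ¬Pz₁
        ... | z' , z'≤ , hz' , ¬pz'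
          with topmost (λ u → highsBelow? x₀ u ×-dec ¬? (P? u)) z'
        ...   | inj₁ (δ , δ≤ , qδ , least) = δ , ≤T-trans δ≤ z'≤ , qδ , least
        ...   | inj₂ none = ⊥-elim (none z' here (hz' , ¬pz'))

        module After (δ : Fin m) (δ≤z₁ : δ ≤T z₁) (x₀δ : HighsBelow x₀ δ) (¬Pδ : ¬ P δ)
                     (x₀-least : ∀ y → y ≤T δ → HighsBelow x₀ y × ¬ P y → y ≡ δ) where
          δ≤s : δ ≤T s (k + D)
          δ≤s = ≤T-trans (δ≤z₁) (proj₂ z₁-window)

          δ≤sD : δ ≤T s D
          δ≤sD = ≤T-trans (δ≤z₁) z₁≤sD

          δ≤q : δ ≤T q
          δ≤q = ≤T-trans δ≤sD sD≤q

          -- A high of a later child outside `P` and properly above `δ` would, by the sibling rule,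
          -- give `x₀` such a high as well, against the choice of `δ`.
          none-above-δ : ∀ {a b} → a < D + D → o < b → b < o + c' →
                         ∀ {z} → HighsBelow (ch a b) z → ¬ P z → z ≤T δ → z ≡ δ
          none-above-δ a< o<b b< hz ¬pz z≤δ
            with step (col< zero) a< ≤-refl o<b b< (≤T-trans z≤δ δ≤q) hz ¬pz
          ... | z' , z'≤z , x₀z' , ¬pz' with x₀-least z' (≤T-trans z'≤z z≤δ) (x₀z' , ¬pz')
          ...   | refl = ≤T-antisym z≤δ z'≤z

          yδ : Fin n
          yδ = proj₁ x₀δ

          extend : ∀ {o'} → o < o' → o' + c ≤ o + c' →
                   Agree (_≤T δ) o' c → Choice (suc k) col o c' P
          extend {o'} o<o' o'≤ agree' = record
            { b = λ { zero → o ; (suc i) → R.b i }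
            ; y = λ { zero → yδ ; (suc i) → R.y i }
            ; o≤b = λ { zero → ≤-refl ; (suc i) → <⇒≤ (<-≤-trans o<o' (R.o≤b i)) }
            ; b< = λ { zero → o<end ; (suc i) → <-≤-trans (R.b< i) o'≤ }
            ; ch≤y = λ { zero → proj₁ (proj₂ x₀δ) ; (suc i) → R.ch≤y i }
            ; y∉P = λ { zero → subst (¬_ ∘ P) (sym yδ-high) ¬Pδ
                      ; (suc i) pz → ¬Pδ (P-down (proj₁ (δ<y i)) pz) }
            ; y≤s = λ { zero → subst (_≤T s D) (sym yδ-high) δ≤sD ; (suc i) → R.y≤s i }
            ; b-mono = λ { zero (suc j) _ → <-≤-trans o<o' (R.o≤b j)
                         ; (suc i) (suc j) (s≤s i<j) → R.b-mono i j i<j }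
            ; y-mono = λ { zero (suc j) _ → subst (_<T high (R.y j)) (sym yδ-high) (δ<y j)
                         ; (suc i) (suc j) (s≤s i<j) → R.y-mono i j i<j }
            }
            where
            yδ-high : high yδ ≡ δ
            yδ-high = proj₂ (proj₂ x₀δ)

            module R = Choice (choose-k (col ∘ suc) (col< ∘ suc) (<⇒≤ k<D) o' (≤-trans o'≤ o+≤K)
              (_≤T δ) (_≤T? δ) ≤T-trans (λ z z≤δ → ≤T-trans z≤δ δ≤s) agree')

            δ<y : ∀ i → δ <T high (R.y i)
            δ<y i with comparable δ≤q (≤T-trans (R.y≤s i) sD≤q)
            ... | inj₁ δ≤ = δ≤ , λ e → R.y∉P i (≤T-reflexive (sym e))
            ... | inj₂ ≤δ = ⊥-elim (R.y∉P i ≤δ)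

          result : Choice (suc k) col o c' P
          result with highsBelow? xm δ
          -- A child before the middle one must carry a high outside `P` at or above `δ`, and `δ` is
          -- the only candidate.
          ... | yes xmδ = extend (n<1+n o) end≤ agree'
            where
            end≤ : suc o + c ≤ o + c'
            end≤ = ≤-trans (≤-reflexive (sym (+-suc o c))) (<⇒≤ mid<end)

            <mid : ∀ {b} → b < suc o + c → b < mid
            <mid {b} b< = subst (b <_) (sym (+-suc o c)) b<

            has-δ : ∀ {a b} → a < D + D → o < b → b < suc o + c → HighsBelow (ch a b) δ
            has-δ a< o<b b< with step a< wd< (<⇒≤ o<b) (<mid b<) mid<end δ≤q xmδ ¬Pδ
            ... | z' , z'≤δ , hz' , ¬pz' =
              subst (HighsBelow _) (none-above-δ a< o<b (<-≤-trans b< end≤) hz' ¬pz' z'≤δ) hz'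

            agree' : Agree (_≤T δ) (suc o) c
            agree' a< a'< o<b b< o<b' b'< z z≤δ hz with P? z
            ... | yes pz = agree a< a'< (<⇒≤ o<b) (<-≤-trans b< end≤)
                             (<⇒≤ o<b') (<-≤-trans b'< end≤) z pz hz
            ... | no ¬pz with none-above-δ a< o<b (<-≤-trans b< end≤) hz ¬pz z≤δ
            ...   | refl = has-δ a'< o<b' b'<
          -- A later child carrying `δ` would force it on the middle child, so agreement at `δ`
          -- holds vacuously.
          ... | no ¬xmδ = extend (<-trans o<mid (n<1+n mid)) end≤ agree'
            where
            end≤ : suc mid + c ≤ o + c'
            end≤ = ≤-reflexive (trans (cong suc (+-assoc o (suc c) c)) (sym (+-suc o (suc (c + c)))))

            o<- : ∀ {b} → mid < b → o < b
            o<- = <-trans o<mid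

            lacks-δ : ∀ {a b} → a < D + D → mid < b → b < o + c' → ¬ HighsBelow (ch a b) δ
            lacks-δ a< mid<b b< hδ with step wd< a< (<⇒≤ o<mid) mid<b b< δ≤q hδ ¬Pδ
            ... | z' , z'≤δ , hz' , ¬pz' =
              ¬xmδ (subst (HighsBelow _) (none-above-δ wd< o<mid mid<end hz' ¬pz' z'≤δ) hz')

            agree' : Agree (_≤T δ) (suc mid) c
            agree' a< a'< m<b b< m<b' b'< z z≤δ hz with P? z
            ... | yes pz = agree a< a'< (<⇒≤ (o<- m<b)) (<-≤-trans b< end≤)
                             (<⇒≤ (o<- m<b')) (<-≤-trans b'< end≤) z pz hz
            ... | no ¬pz with none-above-δ a< (o<- m<b) (<-≤-trans b< end≤) hz ¬pz z≤δ
            ...   | refl = ⊥-elim (lacks-δ a< m<b (<-≤-trans b< end≤) hz)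

        outcome : Choice (suc k) col o c' P
        outcome with first
        ... | δ , δ≤z₁ , (x₀δ , ¬Pδ) , least = After.result δ δ≤z₁ x₀δ ¬Pδ least

      choose : ∀ k → Choosable k
      choose zero col _ _ o _ P _ _ _ _ = record
        { b = λ () ; y = λ () ; o≤b = λ () ; b< = λ () ; ch≤y = λ () ; y∉P = λ ()
        ; y≤s = λ () ; b-mono = λ () ; y-mono = λ () }
      choose (suc k) = choose-suc (choose k)

-- Descent below the windows: nested nodes or disjoint siblings.

module Descent
  {n m : ℕ} {G : SimpleGraph n} (M : TreeModel G m) (minimal : TreeModel.Minimal M)
  (ρ : Fin m → Fin m) (dfs : TreeModel.IsDFSOrder M ρ)
  {D N : ℕ} (0<D : 0 < D) (0<N : 0 < N)
  (Γ : DFSOrder.Grid M minimal ρ dfs (D + D) N) where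
  open TreeModel M
  open RootedTreeProperties tree
  open DFSOrder M minimal ρ dfs
  open GridProperties 0<D 0<N Γ

  record SiblingPattern (col : Fin D → ℕ) : Set where
    field
      q      : Fin m
      base≤q : base ≤T q
      x      : Fin D → Fin m
      b      : Fin D → ℕ
      y      : Fin D → Fin n
      x-parent    : ∀ i → parent (x i) ≡ just q
      x-injective : Injective _≡_ _≡_ x
      b<N    : ∀ i → b i < N
      x≤w    : ∀ i → x i ≤T low (w (col i) (b i))
      x≤y    : ∀ i → x i ≤T low (y i)
      y≤s    : ∀ i → high (y i) ≤T s D
      y-mono : ∀ i j → toℕ i < toℕ j → high (y i) <T high (y j)

  -- The chain encodes a half-graph: node `x j` is an ancestor of the low end of the `i`-th vertex
  -- exactly when `j ≤ i`.
  record PathPattern (k : ℕ) (col : Fin k → ℕ) (r : Fin m) : Set where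
    field
      x      : Fin k → Fin m
      b      : Fin k → ℕ
      b<N    : ∀ i → b i < N
      r≤x    : ∀ i → r ≤T x i
      x≤w    : ∀ i → x i ≤T low (w (col i) (b i))
      x-mono : ∀ i j → toℕ i < toℕ j → x i ≤T x j
      x≰w    : ∀ i j → toℕ i < toℕ j → ¬ (x j ≤T low (w (col i) (b i)))

  -- Both outcomes take columns prescribed in advance, so that the order of the windows can be any
  -- permutation of the order found below them.
  Descends : (Fin D → ℕ) → ℕ → Set
  Descends col₂ k =
    ∀ (col : Fin k → ℕ) → (∀ i → col i < D + D) →
    ∀ x → base ≤T x → ∀ o → descentBound D k + o ≤ N →
    (∀ {a b} → a < D + D → o ≤ b → b < descentBound D k + o → x ≤T low (w a b)) →
    SiblingPattern col₂ ⊎ PathPattern k col x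

  -- Split the parts into blocks below the lowest common ancestor q of the
  -- first and the last part.  Either the two test parts of some block meet the
  -- same child of q, and all parts between them lie below that child, or
  -- parts of different blocks never meet the same child.
  descend-suc : ∀ {col₂ : Fin D → ℕ} → (∀ i → col₂ i < D + D) →
                ∀ {k} → Descends col₂ k → Descends col₂ (suc k)
  descend-suc {col₂} col₂< {k} descend-k col col< x base≤x o end≤N inside = outcome
    where
    W r E last : ℕ
    W    = D + D
    r    = 3 + descentBound D k
    E    = suc (siblingBound D * r + o)
    last = suc (suc E)

    0<W : 0 < W
    0<W = ≤-trans 0<D (m≤m+n D D)

    1<W : 1 < W
    1<W = +-mono-≤ 0<D 0<D

    o<E : o < E
    o<E = s≤s (m≤n+m o _)

    o<last : o < last
    o<last = <-trans o<E (<-trans (n<1+n E) (n<1+n (suc E)))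

    -- By convexity of subtrees in the depth-first order, all parts strictly between these two lie
    -- below this node.
    lcaₒ = lca (low (w (col zero) o)) (low (w (col zero) last))

    q : Fin m
    q = proj₁ lcaₒ

    q-greatest : ∀ z → z ≤T low (w (col zero) o) → z ≤T low (w (col zero) last) → z ≤T q
    q-greatest = proj₂ (proj₂ (proj₂ lcaₒ))

    x≤first : x ≤T low (w (col zero) o)
    x≤first = inside (col< zero) ≤-refl (<-trans o<last (n<1+n last))

    x≤last : x ≤T low (w (col zero) last)
    x≤last = inside (col< zero) (<⇒≤ o<last) (n<1+n last)

    x≤q : x ≤T q
    x≤q = q-greatest x x≤first x≤last

    q≤w : ∀ {a b} → a < W → o < b → b < last → q ≤T low (w a b)
    q≤w a< o<b b< =
      pos-convex _ (proj₁ (proj₂ lcaₒ)) (proj₁ (proj₂ (proj₂ lcaₒ)))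
        (low-order (col< zero) a< o<b (<-trans b< end≤N)) (low-order a< (col< zero) b< end≤N)

    -- Parts ending at q itself are sorted by their high ends, so no two of
    -- them can both meet all windows.
    q≢w : ∀ {a b} → a < W → o < b → b < E → q ≢ low (w a b)
    q≢w {a} {b} a< o<b b<E q≡ =
      low-tie 0<W 1<W (n<1+n E) E₂<N (trans (ends 0<W b<E (n≤1+n E)) (sym (ends 1<W b<E₂ ≤-refl)))
        (≤T-<T-trans (proj₂ (window 1<W E₂<N)) (proj₁ (window 0<W (<-trans (n<1+n E) E₂<N))))
      where
      E₂<N : suc E < N
      E₂<N = <-trans (n<1+n (suc E)) end≤N
      b<E₂ : b < suc E
      b<E₂ = <-trans b<E (n<1+n E)
      ends : ∀ {a' c} → a' < W → b < c → c ≤ suc E → low (w a' c) ≡ q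
      ends {a'} {c} a'< b<c c≤ = pos-injective (≤-antisym
        (pos-descendant (q≤w a'< (<-trans o<b b<c) (s≤s c≤)))
        (subst (λ z → pos z ≤ pos (low (w a' c))) (sym q≡)
               (low-order a< a'< b<c (≤-<-trans c≤ E₂<N))))

    child : ∀ a b → Fin m
    child a b = branch q (low (w a b))

    <N : ∀ {b} → b < E → b < N
    <N b< = <-trans b< (<-trans (<-trans (n<1+n E) (n<1+n (suc E))) end≤N)

    child-spec : ∀ {a b} → a < W → o < b → b < E →
                 parent (child a b) ≡ just q × child a b ≤T low (w a b)
    child-spec a< o<b b< = branch-spec
      (q≤w a< o<b (<-trans b< (<-trans (n<1+n E) (n<1+n (suc E))))) (q≢w a< o<b b<)

    start test₁ inner test₂ : ℕ → ℕ
    start i = suc (i * r + o)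
    test₁ i = suc (start i)
    inner i = suc (test₁ i)
    test₂ i = descentBound D k + inner i

    o<start : ∀ i → o < start i
    o<start i = s≤s (m≤n+m o (i * r))

    start-mono : ∀ {i j} → i ≤ j → start i ≤ start j
    start-mono i≤j = s≤s (+-monoˡ-≤ o (*-monoˡ-≤ r i≤j))

    test₁<test₂ : ∀ i → test₁ i < test₂ i
    test₁<test₂ i = m≤n+m (inner i) (descentBound D k)

    test₂<start : ∀ i → test₂ i < start (suc i)
    test₂<start i = ≤-reflexive (cong suc (trans (shift _) (cong suc (trans (shift _)
      (cong suc (trans (shift _) (cong suc (sym (+-assoc u (i * r) o)))))))))
      where
      u = descentBound D k
      shift = +-suc u

    start<E : ∀ {i} → i < siblingBound D → test₂ i < E
    start<E {i} i< = <-≤-trans (test₂<start i) (start-mono i<)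

    merge : Dec (∃ λ i → i < siblingBound D × child 0 (test₁ i) ≡ child 0 (test₂ i))
    merge = anyUpTo? (λ i → child 0 (test₁ i) ≟ child 0 (test₂ i)) (siblingBound D)

    o<test₁ : ∀ i → o < test₁ i
    o<test₁ i = m≤n⇒m≤1+n (o<start i)

    o<test₂ : ∀ i → o < test₂ i
    o<test₂ i = <-trans (o<test₁ i) (test₁<test₂ i)

    module Merging {i : ℕ} (i< : i < siblingBound D)
                   (same : child 0 (test₁ i) ≡ child 0 (test₂ i)) where
      spec₁ = child-spec 0<W (o<test₁ i) (<-trans (test₁<test₂ i) (start<E i<))
      spec₂ = child-spec 0<W (o<test₂ i) (start<E i<)

      c : Fin m
      c = child 0 (test₁ i)

      q≤c : q ≤T c
      q≤c = parent⇒≤T (proj₁ spec₁)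

      inside' : ∀ {a b} → a < W → inner i ≤ b → b < test₂ i → c ≤T low (w a b)
      inside' a< ≤b b< =
        pos-convex _ (proj₂ spec₁) (≤T-trans (≤T-reflexive same) (proj₂ spec₂))
          (low-order 0<W a< ≤b (<-trans b< (<N (start<E i<))))
          (low-order a< 0<W b< (<N (start<E i<)))

      -- As `q` is the lowest common ancestor of the first and the last part, its child `c` cannot
      -- be above both; the part that it misses separates `x` from the rest of the chain.
      outside : Σ ℕ λ b → b < N × x ≤T low (w (col zero) b) × ¬ (c ≤T low (w (col zero) b))
      outside with c ≤T? low (w (col zero) o)
      ... | no c≰  = o , <-trans o<last end≤N , x≤first , c≰
      ... | yes c≤ = last , end≤N , x≤last ,
                     λ c≤' → child≰parent (proj₁ spec₁) (q-greatest c c≤ c≤')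

      extend : PathPattern k (col ∘ suc) c → PathPattern (suc k) col x
      extend R = record
        { x = λ { zero → x ; (suc j) → R.x j }
        ; b = λ { zero → proj₁ outside ; (suc j) → R.b j }
        ; b<N = λ { zero → proj₁ (proj₂ outside) ; (suc j) → R.b<N j }
        ; r≤x = λ { zero → here ; (suc j) → x≤R j }
        ; x≤w = λ { zero → proj₁ (proj₂ (proj₂ outside)) ; (suc j) → R.x≤w j }
        ; x-mono = λ { zero (suc j) _ → x≤R j ; (suc i) (suc j) (s≤s i<j) → R.x-mono i j i<j }
        ; x≰w = λ { zero (suc j) _ x≤ →
                      proj₂ (proj₂ (proj₂ outside)) (≤T-trans (R.r≤x j) x≤)
                  ; (suc i) (suc j) (s≤s i<j) → R.x≰w i j i<j }
        }
        where
        module R = PathPattern R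
        x≤R : ∀ j → x ≤T R.x j
        x≤R j = ≤T-trans (≤T-trans x≤q q≤c) (R.r≤x j)

    module Disjoint
      (none : ¬ ∃ λ i → i < siblingBound D × child 0 (test₁ i) ≡ child 0 (test₂ i)) where

      spec : ∀ {a i} → a < W → i < siblingBound D →
             parent (child a (start i)) ≡ just q × child a (start i) ≤T low (w a (start i))
      spec {i = i} a< i< =
        child-spec a< (o<start i) (<-trans (<-trans (n<1+n _) (test₁<test₂ i)) (start<E i<))

      -- If the order failed, both start parts would lie below the same child, and by convexity so
      -- would everything between them, including the two test parts of block `i`.
      order : ∀ {a i a' j} → a < W → a' < W → i < j → j < siblingBound D →
              pos (child a (start i)) < pos (child a' (start j))
      order {a} {i} {a'} {j} a< a'< i<j j< = ≰⇒> λ c'≤c →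
        let c≤c' = pos-ancestor (proj₂ (spec a< i<))
                     (≤-trans (low-order a< a'< start< (<N (start<E' j<)))
                              (pos-descendant (proj₂ (spec a'< j<)))) c'≤c
            c≡c' = siblings-disjoint (proj₁ (spec a< i<)) (proj₁ (spec a'< j<)) c≤c' here
            c≤   = proj₂ (spec a< i<)
            c≤w' = ≤T-trans (≤T-reflexive c≡c') (proj₂ (spec a'< j<))
            below : ∀ {t} → start i < t → t < start j →
                    child a (start i) ≡ child 0 t
            below {t} i<t t<j =
              let s' = child-spec 0<W (<-trans (o<start i) i<t) (<-trans t<j (start<E' j<))
              in siblings-disjoint (proj₁ (spec a< i<)) (proj₁ s')
                   (pos-convex _ c≤ c≤w'
                      (low-order a< 0<W i<t (<N (<-trans t<j (start<E' j<))))
                      (low-order 0<W a'< t<j (<N (start<E' j<))))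
                   (proj₂ s')
        in none (i , i< , trans (sym (below (n<1+n _) test₁<j))
                                (below (<-trans (n<1+n _) (test₁<test₂ i)) test₂<j))
        where
        i< = <-trans i<j j<
        start<E' : ∀ {i} → i < siblingBound D → start i < E
        start<E' {i} i< = <-trans (<-trans (n<1+n _) (test₁<test₂ i)) (start<E i<)
        test₂<j : test₂ i < start j
        test₂<j = <-≤-trans (test₂<start i) (start-mono i<j)
        test₁<j : test₁ i < start j
        test₁<j = <-trans (test₁<test₂ i) test₂<j
        start< : start i < start j
        start< = <-trans (n<1+n _) test₁<j

      start<N : ∀ {i} → i < siblingBound D → start i < N
      start<N {i} i< = <N (<-trans (<-trans (n<1+n _) (test₁<test₂ i)) (start<E i<))

      open SiblingParts (≤T-trans base≤x x≤q) start start<N (λ a i → child a (start i))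
             (λ a< i< → proj₁ (spec a< i<)) (λ a< i< → proj₂ (spec a< i<)) order

      fromChoice : Choice D col₂ 0 (siblingBound D) (λ _ → ⊥) → SiblingPattern col₂
      fromChoice R = record
        { q = q ; base≤q = ≤T-trans base≤x x≤q
        ; x = λ i → child (col₂ i) (start (R.b i))
        ; b = λ i → start (R.b i) ; y = R.y
        ; x-parent = λ i → proj₁ (spec (col₂< i) (R.b< i))
        ; x-injective = <-≢⇒injective λ i j i<j e → <-irrefl (cong pos e)
            (order (col₂< i) (col₂< j) (R.b-mono i j i<j) (R.b< j))
        ; b<N = λ i → start<N (R.b< i)
        ; x≤w = λ i → proj₂ (spec (col₂< i) (R.b< i))
        ; x≤y = R.ch≤y ; y≤s = R.y≤s ; y-mono = R.y-mono }
        where module R = Choice R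

      pattern₂ : SiblingPattern col₂
      pattern₂ = fromChoice (choose D col₂ col₂< ≤-refl 0 ≤-refl (λ _ → ⊥) (λ _ → no id)
                               (λ _ ()) (λ _ ()) (λ _ _ _ _ _ _ _ ()))

    outcome : SiblingPattern col₂ ⊎ PathPattern (suc k) col x
    outcome with merge
    ... | no none = inj₁ (Disjoint.pattern₂ none)
    ... | yes (i , i< , same)
      with descend-k (col ∘ suc) (col< ∘ suc) c (≤T-trans base≤x (≤T-trans x≤q q≤c))
             (inner i) (<⇒≤ (<N (start<E i<))) inside'
      where open Merging i< same
    ...   | inj₁ pattern₂ = inj₁ pattern₂
    ...   | inj₂ path     = inj₂ (Merging.extend i< same path)

  descend : ∀ {col₂ : Fin D → ℕ} → (∀ i → col₂ i < D + D) → ∀ k → Descends col₂ k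
  descend col₂< zero _ _ _ _ _ _ _ = inj₂ (record
    { x = λ () ; b = λ () ; b<N = λ () ; r≤x = λ () ; x≤w = λ () ; x-mono = λ () ; x≰w = λ () })
  descend col₂< (suc k) = descend-suc col₂< (descend col₂< k)

-- Lexicographic index orders and the assembly of labelled vertices.

⇔-≤-resp-≡ : ∀ {X : Set} {a b c : ℕ} → a ≡ b → X ⇔ c ≤ a → X ⇔ c ≤ b
⇔-≤-resp-≡ refl e = e

opposite-anti : ∀ {k} {i j : Fin k} → toℕ i ≤ toℕ j → toℕ (opposite j) ≤ toℕ (opposite i)
opposite-anti {k} {i} {j} i≤j =
  subst₂ _≤_ (sym (opposite-prop j)) (sym (opposite-prop i)) (∸-monoʳ-≤ k (s≤s i≤j))

opposite-≤ : ∀ {k} {i j : Fin k} → toℕ (opposite j) ≤ toℕ (opposite i) ⇔ toℕ i ≤ toℕ j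
opposite-≤ {k} {i} {j} =
  mk⇔ (λ le → subst₂ (λ u v → toℕ u ≤ toℕ v) (opposite-involutive i) (opposite-involutive j)
                     (opposite-anti le))
      opposite-anti

transpose : ∀ t → Fin (t * t) → Fin (t * t)
transpose t k = combine (proj₂ (remQuot {t} t k)) (proj₁ (remQuot {t} t k))

transpose-combine : ∀ {t} (i j : Fin t) → transpose t (combine i j) ≡ combine j i
transpose-combine {t} i j =
  cong (λ p → combine (proj₂ p) (proj₁ p)) (remQuot-combine i j)

transpose-involutive : ∀ t k → transpose t (transpose t k) ≡ k
transpose-involutive t k =
  trans (transpose-combine (proj₂ (remQuot {t} t k)) (proj₁ (remQuot {t} t k)))
        (combine-remQuot {t} t k)

combine-≤ : ∀ {t} (i j i' j' : Fin t) →
            toℕ (combine i j) ≤ toℕ (combine i' j') ⇔ (i , j) ≤lex (i' , j')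
combine-≤ {t} i j i' j' = mk⇔ to-lex from-lex
  where
  to-lex : toℕ (combine i j) ≤ toℕ (combine i' j') → (i , j) ≤lex (i' , j')
  to-lex le with <-cmp (toℕ i) (toℕ i')
  ... | tri< i<i' _ _ = inj₁ i<i'
  ... | tri> _ _ i'<i = ⊥-elim (<⇒≱ (combine-monoˡ-< j' j i'<i) le)
  ... | tri≈ _ i≡i' _ with toℕ-injective i≡i'
  ...   | refl = inj₂ (refl , +-cancelˡ-≤ (t * toℕ i) _ _
                   (subst₂ _≤_ (toℕ-combine i j) (toℕ-combine i j') le))
  from-lex : (i , j) ≤lex (i' , j') → toℕ (combine i j) ≤ toℕ (combine i' j')
  from-lex (inj₁ i<i')        = <⇒≤ (combine-monoˡ-< j j' i<i')
  from-lex (inj₂ (refl , j≤j')) =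
    subst₂ _≤_ (sym (toℕ-combine i j)) (sym (toℕ-combine i j')) (+-monoʳ-≤ (t * toℕ i) j≤j')

module _ {X Y : Set} {k : ℕ} (R : X → Y → Set) {f : Fin k → X} {g : Fin k → Y}
         (half : ∀ r s → R (f r) (g s) ⇔ toℕ r ≤ toℕ s) where

  -- Equal vertices have equal neighbourhoods, so each index is at most the other.
  half-graph-injectiveˡ : Injective _≡_ _≡_ f
  half-graph-injectiveˡ {r} {s} e = toℕ-injective (≤-antisym
    (to (half r s) (subst (λ x → R x (g s)) (sym e) (from (half s s) ≤-refl)))
    (to (half s r) (subst (λ x → R x (g r)) e (from (half r r) ≤-refl))))

  half-graph-injectiveʳ : Injective _≡_ _≡_ g
  half-graph-injectiveʳ {r} {s} e = toℕ-injective (≤-antisym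
    (to (half r s) (subst (R (f r)) e (from (half r r) ≤-refl)))
    (to (half s r) (subst (R (f s)) (sym e) (from (half s s) ≤-refl))))

-- The vertices b k are numbered by their lexicographic position in C-order,
-- (j , i); transpose turns it into the A-order (i , j).
semiInducedGTP :
  ∀ {n} {G : SimpleGraph n} (t ℓ : ℕ)
  (a : Fin (t * t) → Fin n) (b : Fin (suc ℓ) → Fin (t * t) → Fin n) (c : Fin (t * t) → Fin n) →
  (∀ r s → SimpleGraph.Adj G (a r) (b zero s) ≡ true ⇔ toℕ r ≤ toℕ (transpose t s)) →
  (∀ (k : Fin ℓ) r s → SimpleGraph.Adj G (b (inject₁ k) r) (b (suc k) s) ≡ true ⇔ r ≡ s) →
  (∀ s r → SimpleGraph.Adj G (b (fromℕ ℓ) s) (c r) ≡ true ⇔ toℕ s ≤ toℕ r) →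
  (∀ r k s → a r ≢ b k s) → (∀ r k s → c r ≢ b k s) → (∀ r s → a r ≢ c s) →
  (∀ k r k' r' → b k r ≡ b k' r' → k ≡ k' × r ≡ r') →
  SemiInducedGTP G t ℓ
semiInducedGTP {n} {G} t ℓ a b c ab bb bc a≢b c≢b a≢c b-injective = record
  { vtx = vtx ; inj = λ {u} {v} → vtx-injective u v
  ; adjAB = λ i j i' j' →
      ⇔.trans (ab _ _) (subst (λ k → toℕ (combine i j) ≤ toℕ k ⇔ (i , j) ≤lex (i' , j'))
                               (sym (transpose-combine j' i')) (combine-≤ i j i' j'))
  ; adjBB = λ k i j i' j' →
      ⇔.trans (bb k _ _) (mk⇔ (λ e → swap (combine-injective j i j' i' e))
                               (λ { (refl , refl) → refl }))
  ; adjBC = λ i j i' j' → ⇔.trans (bc _ _) (combine-≤ j i j' i')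
  }
  where
  open SimpleGraph G using (Adj)

  vtx : Label t ℓ → Fin n
  vtx (A i j)   = a (combine i j)
  vtx (B k i j) = b k (combine j i)
  vtx (C i j)   = c (combine j i)

  a-injective : Injective _≡_ _≡_ a
  a-injective = half-graph-injectiveˡ (λ u v → Adj u v ≡ true)
    {g = λ s → b zero (transpose t s)}
    (λ r s → ⇔-≤-resp-≡ (cong toℕ (transpose-involutive t s)) (ab r (transpose t s)))

  c-injective : Injective _≡_ _≡_ c
  c-injective = half-graph-injectiveʳ (λ u v → Adj u v ≡ true) bc

  vtx-injective : ∀ u v → vtx u ≡ vtx v → u ≡ v
  vtx-injective (A i j) (A i' j') e with combine-injective i j i' j' (a-injective e)
  ... | refl , refl = refl
  vtx-injective (B k i j) (B k' i' j') e with b-injective k _ k' _ e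
  ... | refl , e' with combine-injective j i j' i' e'
  ...   | refl , refl = refl
  vtx-injective (C i j) (C i' j') e with combine-injective j i j' i' (c-injective e)
  ... | refl , refl = refl
  vtx-injective (A _ _) (B _ _ _) e = ⊥-elim (a≢b _ _ _ e)
  vtx-injective (A _ _) (C _ _) e   = ⊥-elim (a≢c _ _ e)
  vtx-injective (B _ _ _) (A _ _) e = ⊥-elim (a≢b _ _ _ (sym e))
  vtx-injective (B _ _ _) (C _ _) e = ⊥-elim (c≢b _ _ _ (sym e))
  vtx-injective (C _ _) (A _ _) e   = ⊥-elim (a≢c _ _ (sym e))
  vtx-injective (C _ _) (B _ _ _) e = ⊥-elim (c≢b _ _ _ e)

-- From the two patterns to transversal pairs.

module TransversalPairs
  {n m : ℕ} {G : SimpleGraph n} (M : TreeModel G m) (minimal : TreeModel.Minimal M)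
  (ρ : Fin m → Fin m) (dfs : TreeModel.IsDFSOrder M ρ)
  (t : ℕ) {N : ℕ} (0<D : 0 < t * t) (0<N : 0 < N)
  (Γ : DFSOrder.Grid M minimal ρ dfs (t * t + t * t) N) where
  open SimpleGraph G using (Adj)
  open TreeModel M
  open RootedTreeProperties tree
  open MinimalModel M minimal
  open DFSOrder M minimal ρ dfs
  open GridProperties 0<D 0<N Γ
  open Descent M minimal ρ dfs 0<D 0<N Γ

  adj-comm : ∀ {u v} → Adj u v ≡ true ⇔ Adj v u ≡ true
  adj-comm = mk⇔ (trans (SimpleGraph.sym G _ _)) (trans (SimpleGraph.sym G _ _))

  toℕ<D+D : (r : Fin (t * t)) → toℕ r < t * t + t * t
  toℕ<D+D r = <-≤-trans (toℕ<n r) (m≤m+n _ _)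

  s<base' : (r : Fin (t * t)) → s (toℕ r) <T base
  s<base' r = s<base (<⇒≤ (toℕ<D+D r))

  sD<base : s (t * t) <T base
  sD<base = s<base (m≤m+n _ _)

  a : Fin (t * t) → Fin n
  a r = proj₁ (leaving (s<base' r))

  a-leaves : ∀ r → Leaves (s (toℕ r)) base (a r)
  a-leaves r = proj₂ (leaving (s<base' r))

  w∋base : ∀ {k b} → k < t * t + t * t → b < N → InPath (w k b) base
  w∋base k< b< = high≤base k< b< , base≤low k< b<

  -- Every `w` passes through `base`, so its adjacency to `a r` depends on its window only. This is
  -- the first half-graph of both outcomes.
  a-w-adj : ∀ r {k b} → k < t * t + t * t → b < N → Adj (a r) (w k b) ≡ true ⇔ toℕ r ≤ k
  a-w-adj r k< b< =
    ⇔.trans (leaving-adj (s<base' r) (a-leaves r) (w∋base k< b<)) (window-≤T k< (toℕ<D+D r) b<)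

  ∌base⇒≢ : ∀ {u v} → ¬ InPath u base → InPath v base → u ≢ v
  ∌base⇒≢ u∌ v∋ refl = u∌ v∋

  high-<T⇒≢ : ∀ {u v} → high u <T high v → u ≢ v
  high-<T⇒≢ u<v refl = proj₂ u<v refl

  leaves-high : ∀ {z v} → z <T base → Leaves z base v → high v <T base
  leaves-high z< lv = ≤T-<T-trans (proj₁ (proj₁ lv)) z<

  startingAt : ∀ {x} → base ≤T x → Σ (Fin n) λ v → high v ≡ x
  startingAt base≤x with <T-≤T-trans s₀<base base≤x
  ... | here , s≢x      = ⊥-elim (s≢x refl)
  ... | there e _ , _ = starting e

  w-high : ∀ {k b} → k < t * t + t * t → b < N → high (w k b) <T base
  w-high k< b< = ≤T-<T-trans (proj₂ (window k< b<)) (s<base (<⇒≤ k<))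

  -- The chain runs against the order required between `b` and `c`, hence `opposite`; `transpose`
  -- gives the order required between `a` and `b`.
  pathColumn : Fin (t * t) → ℕ
  pathColumn i = toℕ (transpose t (opposite i))

  -- A vertex starting at a node of the chain meets the `b` vertices whose low end is in the subtree
  -- of this node, which is the second half-graph.
  fromPath : PathPattern (t * t) pathColumn base → SemiInducedGTP G t 0
  fromPath path = semiInducedGTP t 0 a (λ _ → b) c
    (λ r s → ⇔-≤-resp-≡ (cong (toℕ ∘ transpose t) (opposite-involutive s))
                   (a-w-adj r (col< (opposite s)) (P.b<N (opposite s))))
    (λ ())
    (λ s r → ⇔.trans adj-comm
              (⇔.trans (start-adj (c-high r) (c≢b r s)
                          (≤T-trans (proj₁ (b-high s)) (P.r≤x (opposite r))))
              (⇔.trans (x≤w⇔ (opposite r) (opposite s)) opposite-≤)))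
    (λ r _ s → ∌base⇒≢ (Leaves-¬InPath (s<base' r) (a-leaves r)) (b∋base s))
    (λ r _ s → c≢b r s)
    (λ r s → high-<T⇒≢ (<T-≤T-trans (leaves-high (s<base' r) (a-leaves r)) (base≤c s)))
    (λ { zero r zero r' e → refl , b-injective e })
    where
    module P = PathPattern path
    col< : ∀ i → pathColumn i < t * t + t * t
    col< i = toℕ<D+D _

    b c : Fin (t * t) → Fin n
    b s = w (pathColumn (opposite s)) (P.b (opposite s))
    c r = proj₁ (startingAt (P.r≤x (opposite r)))

    c-high : ∀ r → high (c r) ≡ P.x (opposite r)
    c-high r = proj₂ (startingAt (P.r≤x (opposite r)))

    base≤c : ∀ r → base ≤T high (c r)
    base≤c r = ≤T-trans (P.r≤x _) (≤T-reflexive (sym (c-high r)))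

    b-high : ∀ s → high (b s) <T base
    b-high s = w-high (col< (opposite s)) (P.b<N (opposite s))

    b∋base : ∀ s → InPath (b s) base
    b∋base s = w∋base (col< (opposite s)) (P.b<N (opposite s))

    c≢b : ∀ r s → c r ≢ b s
    c≢b r s = high-<T⇒≢ (<T-≤T-trans (b-high s) (base≤c r)) ∘ sym

    x≤w⇔ : ∀ i j → P.x i ≤T low (w (pathColumn j) (P.b j)) ⇔ toℕ i ≤ toℕ j
    x≤w⇔ i j = mk⇔ (λ x≤ → ≮⇒≥ λ j<i → P.x≰w j i j<i x≤) x≤
      where
      x≤ : toℕ i ≤ toℕ j → P.x i ≤T low (w (pathColumn j) (P.b j))
      x≤ i≤j with m≤n⇒m<n∨m≡n i≤j
      ... | inj₁ i<j = ≤T-trans (P.x-mono i j i<j) (P.x≤w j)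
      ... | inj₂ i≡j with toℕ-injective i≡j
      ...   | refl = P.x≤w j

    b-injective : Injective _≡_ _≡_ b
    b-injective {r} {s} e with half-graph-injectiveʳ (λ x v → x ≤T low v) x≤w⇔
                                 {opposite r} {opposite s} e
    ... | e' = trans (sym (opposite-involutive r))
                     (trans (cong opposite e') (opposite-involutive s))

  siblingColumn : Fin (t * t) → ℕ
  siblingColumn i = toℕ (transpose t i)

  -- Among the `w` and the `y`, a vertex starting at the sibling `x i` meets exactly those of index
  -- `i`; this gives the two matchings. The vertices `c` leave the root path of `base` at the highs
  -- of the `y`, whose nesting gives the second half-graph.
  fromSiblings : SiblingPattern siblingColumn → SemiInducedGTP G t 2
  fromSiblings siblings = semiInducedGTP t 2 a b c
    (λ r s → a-w-adj r (toℕ<D+D _) (P.b<N s))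
    matching
    (λ s r → ⇔.trans adj-comm
              (⇔.trans (leaving-adj (y-high r) (proj₂ (leaving (y-high r))) (b∋base₂ s)) (y≤y⇔ s r)))
    (λ { r zero s → ∌base⇒≢ (a∌base r) (b∋base₀ s)
       ; r (suc zero) s → high-<T⇒≢ (<T-≤T-trans (leaves-high (s<base' r) (a-leaves r)) (base≤b₁ s))
       ; r (suc (suc zero)) s → ∌base⇒≢ (a∌base r) (b∋base₂ s) })
    (λ { r zero s → ∌base⇒≢ (c∌base r) (b∋base₀ s)
       ; r (suc zero) s → high-<T⇒≢ (<T-≤T-trans (leaves-high (y-high r) (c-leaves r)) (base≤b₁ s))
       ; r (suc (suc zero)) s → ∌base⇒≢ (c∌base r) (b∋base₂ s) })
    a≢c
    b-injective
    where
    module P = SiblingPattern siblings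

    q<x : ∀ i → P.q <T P.x i
    q<x i = parent⇒≤T (P.x-parent i) , λ e → child≰parent (P.x-parent i) (≤T-reflexive (sym e))

    base<x : ∀ i → base <T P.x i
    base<x i = ≤T-<T-trans P.base≤q (q<x i)

    y-high : ∀ i → high (P.y i) <T base
    y-high i = ≤T-<T-trans (P.y≤s i) sD<base

    b : Fin 3 → Fin (t * t) → Fin n
    b zero             i = w (siblingColumn i) (P.b i)
    b (suc zero)       i = proj₁ (startingAt (proj₁ (base<x i)))
    b (suc (suc zero)) i = P.y i

    c : Fin (t * t) → Fin n
    c r = proj₁ (leaving (y-high r))

    c-leaves : ∀ r → Leaves (high (P.y r)) base (c r)
    c-leaves r = proj₂ (leaving (y-high r))

    b₁-high : ∀ i → high (b (suc zero) i) ≡ P.x i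
    b₁-high i = proj₂ (startingAt (proj₁ (base<x i)))

    base≤b₁ : ∀ i → base ≤T high (b (suc zero) i)
    base≤b₁ i = ≤T-trans (proj₁ (base<x i)) (≤T-reflexive (sym (b₁-high i)))

    b₀-high : ∀ i → high (b zero i) <T base
    b₀-high i = w-high (toℕ<D+D _) (P.b<N i)

    y<b₀ : ∀ i j → high (P.y i) <T high (b zero j)
    y<b₀ i j = ≤T-<T-trans (≤T-trans (P.y≤s i) (s-anti (toℕ<n (transpose t j)) (m≤m+n _ _)))
                            (proj₁ (window (toℕ<D+D _) (P.b<N j)))

    b∋base₀ : ∀ i → InPath (b zero i) base
    b∋base₀ i = w∋base (toℕ<D+D _) (P.b<N i)

    b∋base₂ : ∀ i → InPath (P.y i) base
    b∋base₂ i = proj₁ (y-high i) , ≤T-trans (proj₁ (base<x i)) (P.x≤y i)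

    a∌base : ∀ r → ¬ InPath (a r) base
    a∌base r = Leaves-¬InPath (s<base' r) (a-leaves r)

    c∌base : ∀ r → ¬ InPath (c r) base
    c∌base r = Leaves-¬InPath (y-high r) (c-leaves r)

    -- A vertex leaves the root path of `base` at only one node. For `a` this is `s r` with
    -- `r < t * t`, for `c` a node at or above `s (t * t)`.
    a≢c : ∀ r s → a r ≢ c s
    a≢c r i e = <T⇒≱T (≤T-<T-trans (P.y≤s i) sD<r) (≤T-reflexive
      (Leaves-unique (proj₁ (s<base' r)) (proj₁ (y-high i)) (a-leaves r)
        (subst (Leaves _ base) (sym e) (c-leaves i))))
      where
      sD<r : s (t * t) <T s (toℕ r)
      sD<r = let (lo , hi) = window (toℕ<D+D r) 0<N
             in <T-≤T-trans (≤T-<T-trans (s-anti (toℕ<n r) (m≤m+n _ _)) lo) hi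

    x≤b : ∀ k i → P.x i ≤T low (b k i)
    x≤b zero i             = P.x≤w i
    x≤b (suc zero) i       = ≤T-trans (≤T-reflexive (sym (b₁-high i))) (high≤low _)
    x≤b (suc (suc zero)) i = P.x≤y i

    x≤b⇒≡ : ∀ k i j → P.x i ≤T low (b k j) → i ≡ j
    x≤b⇒≡ k i j x≤ =
      P.x-injective (siblings-disjoint (P.x-parent i) (P.x-parent j) x≤ (x≤b k j))

    b-high-apart : ∀ k k' r r' → b k r ≡ b k' r' → k ≡ k'
    b-high-apart zero zero _ _ _ = refl
    b-high-apart (suc zero) (suc zero) _ _ _ = refl
    b-high-apart (suc (suc zero)) (suc (suc zero)) _ _ _ = refl
    b-high-apart zero (suc zero) r r' e =
      ⊥-elim (high-<T⇒≢ (<T-≤T-trans (b₀-high r) (base≤b₁ r')) e)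
    b-high-apart (suc zero) zero r r' e =
      ⊥-elim (high-<T⇒≢ (<T-≤T-trans (b₀-high r') (base≤b₁ r)) (sym e))
    b-high-apart zero (suc (suc zero)) r r' e = ⊥-elim (high-<T⇒≢ (y<b₀ r' r) (sym e))
    b-high-apart (suc (suc zero)) zero r r' e = ⊥-elim (high-<T⇒≢ (y<b₀ r r') e)
    b-high-apart (suc zero) (suc (suc zero)) r r' e =
      ⊥-elim (high-<T⇒≢ (<T-≤T-trans (y-high r') (base≤b₁ r)) (sym e))
    b-high-apart (suc (suc zero)) (suc zero) r r' e =
      ⊥-elim (high-<T⇒≢ (<T-≤T-trans (y-high r) (base≤b₁ r')) e)

    b-injective : ∀ k r k' r' → b k r ≡ b k' r' → k ≡ k' × r ≡ r'
    b-injective k r k' r' e =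
      b-high-apart k k' r r' e ,
      x≤b⇒≡ k' r r' (subst (λ v → P.x r ≤T low v) e (x≤b k r))

    b₁-adj : ∀ k i j → b (suc zero) i ≢ b k j → high (b k j) ≤T P.x i →
             Adj (b (suc zero) i) (b k j) ≡ true ⇔ i ≡ j
    b₁-adj k i j distinct high≤ = ⇔.trans (start-adj (b₁-high i) distinct high≤)
      (mk⇔ (x≤b⇒≡ k i j) (λ { refl → x≤b k i }))

    matching : ∀ (k : Fin 2) r s → Adj (b (inject₁ k) r) (b (suc k) s) ≡ true ⇔ r ≡ s
    matching zero r s = ⇔.trans adj-comm (⇔.trans
      (b₁-adj zero s r (λ e → contradiction (b-high-apart (suc zero) zero s r e) λ ())
              (≤T-trans (proj₁ (b₀-high r)) (proj₁ (base<x s))))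
      (mk⇔ sym sym))
    matching (suc zero) r s =
      b₁-adj (suc (suc zero)) r s (λ e → contradiction (b-high-apart (suc zero) (suc (suc zero)) r s e) λ ())
             (≤T-trans (proj₁ (y-high s)) (proj₁ (base<x r)))

    y≤y⇔ : ∀ s r → high (P.y s) ≤T high (P.y r) ⇔ toℕ s ≤ toℕ r
    y≤y⇔ s r = mk⇔ (λ le → ≮⇒≥ λ r<s → <T⇒≱T (P.y-mono r s r<s) le) mono
      where
      mono : toℕ s ≤ toℕ r → high (P.y s) ≤T high (P.y r)
      mono s≤r with m≤n⇒m<n∨m≡n s≤r
      ... | inj₁ s<r = proj₁ (P.y-mono s r s<r)
      ... | inj₂ s≡r with toℕ-injective s≡r
      ...   | refl = here

-- Extraction of a grid from cells with three distinct rows or columns.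

totalize : ∀ {X : Set} {k : ℕ} {P : ℕ → X → Set} → X → (∀ a → a < k → Σ X (P a)) →
           Σ (ℕ → X) λ f → ∀ {a} → a < k → P a (f a)
totalize {X} {k} {P} default pick = f , f-spec
  where
  f : ℕ → X
  f a with a <? k
  ... | yes a<k = proj₁ (pick a a<k)
  -- Arbitrary value; `f-spec` speaks of `a < k` only.
  ... | no _    = default
  f-spec : ∀ {a} → a < k → P a (f a)
  f-spec {a} a<k with a <? k
  ... | yes a<k' = proj₂ (pick a a<k')
  ... | no a≮k   = ⊥-elim (a≮k a<k)

≢⇒one-true : ∀ {x y : Bool} → x ≢ y → (x ≡ true × y ≢ true) ⊎ (y ≡ true × x ≢ true)
≢⇒one-true {true}  {true}  x≢y = ⊥-elim (x≢y refl)
≢⇒one-true {true}  {false} _   = inj₁ (refl , λ ())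
≢⇒one-true {false} {true}  _   = inj₂ (refl , λ ())
≢⇒one-true {false} {false} x≢y = ⊥-elim (x≢y refl)

module GridExtraction
  {n m : ℕ} {G : SimpleGraph n} (M : TreeModel G m) (minimal : TreeModel.Minimal M)
  (ρ : Fin m → Fin m) (dfs : TreeModel.IsDFSOrder M ρ)
  (σ : Fin n → Fin n) (order : TreeModel.IsVertexOrder M ρ σ) where
  open TreeModel M
  open RootedTreeProperties tree
  open DFSOrder M minimal ρ dfs

  hi lo : Fin n → Fin m
  hi i = high (σ i)
  lo i = low (σ i)

  Mx : Fin n → Fin n → Bool
  Mx = adjMatrix G σ

  Mx-sym : ∀ i j → Mx i j ≡ Mx j i
  Mx-sym i j = SimpleGraph.sym G (σ i) (σ j)

  lo-order : ∀ {i j} → toℕ i < toℕ j → pos (lo i) ≤ pos (lo j)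
  lo-order {i} {j} i<j = ≮⇒≥ λ lt → <-asym i<j (proj₂ order j i (inj₁ lt))

  lo-tie : ∀ {i j} → toℕ i < toℕ j → lo i ≡ lo j → ¬ (hi j <T hi i)
  lo-tie {i} {j} i<j e lt = <-asym i<j (proj₂ order j i (inj₂ (sym e , lt)))

  Distinct : (Fin n → Set) → (Fin n → Set) → Set
  Distinct X Y = AtLeastDistinctRows Mx X Y 3

  Cell : (Fin n → Set) → (Fin n → Set) → Set
  Cell X Y = Distinct X Y ⊎ Distinct Y X

  -- A vertex u violating hi u ≤ γ u has an empty row, so among three distinct
  -- rows at least two are governed by hi w ≤ γ u alone.
  module Crossing {X Y : Fin n → Set} (γ : Fin n → Fin m)
    (adj⇔ : ∀ {u w} → X u → Y w → Mx u w ≡ true ⇔ (hi w ≤T γ u × hi u ≤T γ u)) where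

    Crossed : Set
    Crossed = Σ (Fin n) λ u → Σ (Fin n) λ u' → Σ (Fin n) λ w →
              X u × X u' × Y w × ¬ (hi w ≤T γ u) × hi w ≤T γ u'

    fromRows : Distinct X Y → Crossed
    fromRows (f , x , distinct) = go (live? zero) (live? (suc zero)) (live? (suc (suc zero)))
      where
      Live : Fin 3 → Set
      Live a = hi (f a) ≤T γ (f a)

      live? : ∀ a → Dec (Live a)
      live? a = hi (f a) ≤T? γ (f a)

      dead : ∀ {a b} → a ≢ b → ¬ Live a → ¬ Live b → ⊥
      dead {a} {b} a≢b ¬la ¬lb with distinct a b a≢b
      ... | j , yj , ≢ with ≢⇒one-true ≢
      ...   | inj₁ (e , _) = ¬la (proj₂ (to (adj⇔ (x a) yj) e))
      ...   | inj₂ (e , _) = ¬lb (proj₂ (to (adj⇔ (x b) yj) e))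

      live : ∀ {a b} → a ≢ b → Live a → Live b → Crossed
      live {a} {b} a≢b la lb with distinct a b a≢b
      ... | j , yj , ≢ with ≢⇒one-true ≢
      ...   | inj₁ (e , ne) = f b , f a , j , x b , x a , yj ,
                (λ h → ne (from (adj⇔ (x b) yj) (h , lb))) , proj₁ (to (adj⇔ (x a) yj) e)
      ...   | inj₂ (e , ne) = f a , f b , j , x a , x b , yj ,
                (λ h → ne (from (adj⇔ (x a) yj) (h , la))) , proj₁ (to (adj⇔ (x b) yj) e)

      go : Dec (Live zero) → Dec (Live (suc zero)) → Dec (Live (suc (suc zero))) → Crossed
      go (yes l₀) (yes l₁) _        = live (λ ()) l₀ l₁
      go (yes l₀) (no _)   (yes l₂) = live (λ ()) l₀ l₂
      go (yes _)  (no d₁)  (no d₂)  = ⊥-elim (dead (λ ()) d₁ d₂)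
      go (no _)   (yes l₁) (yes l₂) = live (λ ()) l₁ l₂
      go (no d₀)  (yes _)  (no d₂)  = ⊥-elim (dead (λ ()) d₀ d₂)
      go (no d₀)  (no d₁)  _        = ⊥-elim (dead (λ ()) d₀ d₁)

    -- A separating `u` orients each pair of columns. A tournament on three vertices has a directed
    -- path with two edges, and its middle column is the required `w`.
    fromCols : Distinct Y X → Crossed
    fromCols (f , y , distinct) =
      go (orient zero (suc zero) λ ()) (orient (suc zero) (suc (suc zero)) λ ())
         (orient zero (suc (suc zero)) λ ())
      where
      Separated : Fin 3 → Fin 3 → Set
      Separated a b = Σ (Fin n) λ u → X u × hi (f a) ≤T γ u × ¬ (hi (f b) ≤T γ u)

      separated : ∀ {a b u} → X u → Mx (f a) u ≡ true → Mx (f b) u ≢ true → Separated a b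
      separated {a} {b} {u} xu e ne with to (adj⇔ xu (y a)) (trans (Mx-sym u (f a)) e)
      ... | h , l = u , xu , h ,
            λ h' → ne (trans (Mx-sym (f b) u) (from (adj⇔ xu (y b)) (h' , l)))

      orient : ∀ a b → a ≢ b → Separated a b ⊎ Separated b a
      orient a b a≢b with distinct a b a≢b
      ... | u , xu , ≢ with ≢⇒one-true ≢
      ...   | inj₁ (e , ne) = inj₁ (separated xu e ne)
      ...   | inj₂ (e , ne) = inj₂ (separated xu e ne)

      join : ∀ {a b c} → Separated a b → Separated b c → Crossed
      join {b = b} (u , xu , _ , ¬h) (u' , xu' , h' , _) = u , u' , f b , xu , xu' , y b , ¬h , h'

      go : Separated zero (suc zero) ⊎ Separated (suc zero) zero →
           Separated (suc zero) (suc (suc zero)) ⊎ Separated (suc (suc zero)) (suc zero) →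
           Separated zero (suc (suc zero)) ⊎ Separated (suc (suc zero)) zero → Crossed
      go (inj₁ p) (inj₁ q) _        = join p q
      go (inj₂ p) (inj₂ q) _        = join q p
      go (inj₁ p) (inj₂ _) (inj₂ r) = join r p
      go (inj₁ _) (inj₂ q) (inj₁ r) = join r q
      go (inj₂ p) (inj₁ _) (inj₁ r) = join p r
      go (inj₂ _) (inj₁ q) (inj₂ r) = join q r

    crossing : Cell X Y → Crossed
    crossing (inj₁ rows) = fromRows rows
    crossing (inj₂ cols) = fromCols cols

  module Windows {W N : ℕ} (0<N : 0 < N)
    (X Y : ℕ → Fin n → Set) (γ : Fin n → Fin m)
    (adj⇔ : ∀ {a b u w} → a < 3 + W * 2 → b < N → X a u → Y b w →
            Mx u w ≡ true ⇔ (hi w ≤T γ u × hi u ≤T γ u))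
    (γ-anti : ∀ {a a' u u'} → a < a' → a' < 3 + W * 2 → X a u → X a' u' → γ u' ≤T γ u)
    (γ≤lo : ∀ {a b u w} → a < 3 + W * 2 → b < N → X a u → Y b w → γ u ≤T lo w)
    (Y-order : ∀ {b b' w w'} → b < b' → b' < N → Y b w → Y b' w' → toℕ w < toℕ w')
    (cell : ∀ {a b} → a < 3 + W * 2 → b < N → Cell (X a) (Y b)) where

    -- The parts `0` to `2` leave a strict gap between `base` and `s 0`; each window takes two more
    -- parts.
    K : ℕ
    K = 3 + W * 2

    crossed : ∀ {a b} (a< : a < K) (b< : b < N) → Crossing.Crossed γ (adj⇔ a< b<)
    crossed a< b< = Crossing.crossing γ (adj⇔ a< b<) (cell a< b<)

    picked : Σ (ℕ → Fin n) λ f → ∀ {a} → a < K → X a (f a)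
    picked = totalize {P = X} (proj₁ (crossed (s≤s z≤n) 0<N))
      λ a a< → let (u , _ , _ , xu , _) = crossed a< 0<N in u , xu

    v : ℕ → Fin n
    v = proj₁ picked

    v∈X : ∀ {a} → a < K → X a (v a)
    v∈X = proj₂ picked

    -- The crossing in part `1 + a` gives a `w` whose high is an ancestor of `γ u'` but not of
    -- `γ u`. Both nodes lie between those of the neighbouring representatives, which therefore
    -- enclose `hi w`.
    between : ∀ {a b} → 2 + a < K → b < N →
              Σ (Fin n) λ w → Y b w × γ (v (2 + a)) <T hi w × hi w ≤T γ (v a)
    between {a} a+2< b<
      with crossed (<-trans (n<1+n _) a+2<) b<
    ... | u , u' , w , xu , xu' , yw , ¬h , h = w , yw , below , ≤T-trans h
            (γ-anti (n<1+n a) a+1< (v∈X (<-trans (n<1+n a) a+1<)) xu')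
      where
      a+1< : 1 + a < K
      a+1< = <-trans (n<1+n _) a+2<
      v≤u : γ (v (2 + a)) ≤T γ u
      v≤u = γ-anti (n<1+n _) a+2< xu (v∈X a+2<)
      v≤u' : γ (v (2 + a)) ≤T γ u'
      v≤u' = γ-anti (n<1+n _) a+2< xu' (v∈X a+2<)
      below : γ (v (2 + a)) <T hi w
      below with comparable v≤u' h
      ... | inj₁ v≤h = v≤h , λ e → ¬h (≤T-trans (≤T-reflexive (sym e)) v≤u)
      ... | inj₂ h≤v = ⊥-elim (¬h (≤T-trans h≤v v≤u))

    index< : ∀ {a} → a < W → 4 + a * 2 < K
    index< a< = s≤s (s≤s (s≤s (*-monoˡ-≤ 2 a<)))

    placed : Σ (ℕ → ℕ → Fin n) λ f → ∀ {a} → a < W → ∀ {b} → b < N →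
             Y b (f a b) × γ (v (4 + a * 2)) <T hi (f a b) × hi (f a b) ≤T γ (v (2 + a * 2))
    placed = totalize
      {P = λ a f → ∀ {b} → b < N → Y b (f b) × γ (v (4 + a * 2)) <T hi (f b) × hi (f b) ≤T γ (v (2 + a * 2))}
      (λ _ → v 0) λ a a< → totalize
        {P = λ b w → Y b w × γ (v (4 + a * 2)) <T hi w × hi w ≤T γ (v (2 + a * 2))}
        (v 0) λ b b< → between (index< a<) b<

    grid : Grid W N
    grid = record
      { base = γ (v 0)
      ; s = λ a → γ (v (2 + a * 2))
      ; w = λ a b → σ (proj₁ placed a b)
      ; s₀<base = let (_ , _ , lt , le) = between (s≤s (s≤s (s≤s z≤n))) 0<N in <T-≤T-trans lt le
      ; window = λ a< b< → proj₂ (proj₂ placed a< b<)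
      ; base≤low = λ a< b< → γ≤lo (s≤s z≤n) b< (v∈X (s≤s z≤n)) (proj₁ (proj₂ placed a< b<))
      ; low-order = λ a< a'< b<b' b'< → lo-order (increasing a< a'< b<b' b'<)
      ; low-tie = λ a< a'< b<b' b'< → lo-tie (increasing a< a'< b<b' b'<)
      }
      where
      increasing : ∀ {a b a' b'} → a < W → a' < W → b < b' → b' < N →
                   toℕ (proj₁ placed a b) < toℕ (proj₁ placed a' b')
      increasing a< a'< b<b' b'< =
        Y-order b<b' b'< (proj₁ (proj₂ placed a< (<-trans b<b' b'<))) (proj₁ (proj₂ placed a'< b'<))

  Cell-nonempty : ∀ {X Y} → Cell X Y → ∃ X × ∃ Y
  Cell-nonempty (inj₁ (f , x , distinct)) with distinct zero (suc zero) (λ ())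
  ... | j , yj , _ = (f zero , x zero) , (j , yj)
  Cell-nonempty (inj₂ (f , y , distinct)) with distinct zero (suc zero) (λ ())
  ... | i , xi , _ = (i , xi) , (f zero , y zero)

  -- γ increases on X and decreases on Y, so comparing it at one middle element
  -- of each side selects halves of X and Y on which the smaller of γ u and γ w
  -- always comes from the same side.
  module Separated {W N L : ℕ} (0<N : 0 < N) (K≤L : 3 + W * 2 ≤ L) (N≤L : N ≤ L)
    (X Y : ℕ → Fin n → Set)
    (X-order : ∀ {a a' i i'} → a < a' → a' < 2 + (L + L) → X a i → X a' i' → toℕ i < toℕ i')
    (Y-order : ∀ {b b' j j'} → b < b' → b' < 2 + (L + L) → Y b j → Y b' j' → toℕ j < toℕ j')
    (X<Y : ∀ {a b i j} → a < 2 + (L + L) → b < 2 + (L + L) → X a i → Y b j → toℕ i < toℕ j)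
    (cell : ∀ {a b} → a < 2 + (L + L) → b < 2 + (L + L) → Cell (X a) (Y b)) where

    H : ℕ
    H = 2 + (L + L)

    L<H : L < H
    L<H = s≤s (≤-trans (m≤m+n L L) (n≤1+n _))

    -- The vertex `e` comes from the last part of `X`, after all other parts of `X` and before all
    -- of `Y`; `u*` and `w*` come from the middle parts.
    e* u* w* : Σ (Fin n) _
    e* = proj₁ (Cell-nonempty (cell {suc (L + L)} {0} ≤-refl (s≤s z≤n)))
    u* = proj₁ (Cell-nonempty (cell L<H L<H))
    w* = proj₂ (Cell-nonempty (cell L<H L<H))

    e : Fin n
    e = proj₁ e*

    p : Fin m
    p = lo e

    γ : Fin n → Fin m
    γ i = proj₁ (lca (lo i) p)

    γ≤lo : ∀ i → γ i ≤T lo i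
    γ≤lo i = proj₁ (proj₂ (lca (lo i) p))

    γ≤p : ∀ i → γ i ≤T p
    γ≤p i = proj₁ (proj₂ (proj₂ (lca (lo i) p)))

    γ-greatest : ∀ {i} z → z ≤T lo i → z ≤T p → z ≤T γ i
    γ-greatest {i} = proj₂ (proj₂ (proj₂ (lca (lo i) p)))

    -- An ancestor common to the low ends of `i` and `e` is, by convexity, also one for every vertex
    -- between them; after `e` the same argument reverses the direction.
    γ-increasing : ∀ {i j} → toℕ i < toℕ j → toℕ j < toℕ e → γ i ≤T γ j
    γ-increasing {i} {j} i<j j<e = γ-greatest (γ i)
      (pos-convex (lo j) (γ≤lo i) (γ≤p i) (lo-order i<j) (lo-order j<e)) (γ≤p i)

    γ-decreasing : ∀ {i j} → toℕ e < toℕ i → toℕ i < toℕ j → γ j ≤T γ i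
    γ-decreasing {i} {j} e<i i<j = γ-greatest (γ j)
      (pos-convex (lo i) (γ≤p j) (γ≤lo j) (lo-order e<i) (lo-order i<j)) (γ≤p j)

    common : ∀ {i j} → toℕ i < toℕ e → toℕ e < toℕ j → ∀ z → z ≤T lo i → z ≤T lo j → z ≤T p
    common i<e e<j z z≤i z≤j = pos-convex p z≤i z≤j (lo-order i<e) (lo-order e<j)

    -- Every common node of the two paths is at or above `p`, hence at or above `γ u`. Conversely
    -- `γ u` is an ancestor of both low ends, so it is common once both highs are at or above it.
    adj⇔ : ∀ {u w} → u ≢ w → (∀ z → z ≤T lo u → z ≤T lo w → z ≤T p) → γ u ≤T γ w →
           Mx u w ≡ true ⇔ (hi w ≤T γ u × hi u ≤T γ u)
    adj⇔ {u} {w} u≢w above γ≤γ = ⇔.trans (edges (σ u) (σ w) (u≢w ∘ proj₁ order)) (mk⇔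
      (λ (z , (hu≤z , z≤lu) , (hw≤z , z≤lw)) →
         let z≤γ = γ-greatest z z≤lu (above z z≤lu z≤lw) in ≤T-trans hw≤z z≤γ , ≤T-trans hu≤z z≤γ)
      (λ (hw≤γ , hu≤γ) → γ u , (hu≤γ , γ≤lo u) , (hw≤γ , ≤T-trans γ≤γ (γ≤lo w))))

    X<e : ∀ {a i} → a < suc (L + L) → X a i → toℕ i < toℕ e
    X<e a< xi = X-order a< ≤-refl xi (proj₂ e*)

    e<Y : ∀ {b j} → b < H → Y b j → toℕ e < toℕ j
    e<Y b< yj = X<Y ≤-refl b< (proj₂ e*) yj

    <L⇒<H : ∀ {a} → a < L → a < H
    <L⇒<H a< = <-trans a< L<H

    <L⇒<e : ∀ {a} → a < L → a < suc (L + L)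
    <L⇒<e a< = <-trans a< (s≤s (m≤m+n L L))

    upper<e : ∀ {a} → a < L → suc (L + a) < suc (L + L)
    upper<e a< = s≤s (+-monoʳ-< L a<)

    upper<H : ∀ {a} → a < L → suc (L + a) < H
    upper<H a< = <-trans (upper<e a<) ≤-refl

    reversed< : ∀ {a} → a < L → L ∸ suc a < L
    reversed< {a} a< = ∸-monoʳ-< {L} {suc a} {0} (s≤s z≤n) a<

    lower-half : γ (proj₁ u*) ≤T γ (proj₁ w*) → Grid W N
    -- The parts of `X` are listed backwards, since `γ` moves away from the root along `X` and the
    -- windows must climb.
    lower-half u*≤w* = Windows.grid 0<N (λ a → X (L ∸ suc a)) Y γ
      (λ a< b< xu yw → adj⇔ (λ { refl → <-irrefl refl (X<Y (<L⇒<H (reversed< (<K a<))) (<L⇒<H (<N b<)) xu yw) })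
         (common (X<e (<L⇒<e (reversed< (<K a<))) xu) (e<Y (<L⇒<H (<N b<)) yw)) (γ≤γ a< b< xu yw))
      (λ a<a' a'< xu xu' → γ-increasing
         (X-order (∸-monoʳ-< (s≤s a<a') (<K a'<)) (<L⇒<H (reversed< (<K (<-trans a<a' a'<)))) xu' xu)
         (X<e (<L⇒<e (reversed< (<K (<-trans a<a' a'<)))) xu))
      (λ a< b< xu yw → ≤T-trans (γ≤γ a< b< xu yw) (γ≤lo _))
      (λ b<b' b'< → Y-order b<b' (<L⇒<H (<N b'<)))
      (λ a< b< → cell (<L⇒<H (reversed< (<K a<))) (<L⇒<H (<N b<)))
      where
      <K : ∀ {a} → a < 3 + W * 2 → a < L
      <K a< = <-≤-trans a< K≤L
      <N : ∀ {b} → b < N → b < L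
      <N b< = <-≤-trans b< N≤L
      γ≤γ : ∀ {a b u w} → a < 3 + W * 2 → b < N → X (L ∸ suc a) u → Y b w → γ u ≤T γ w
      γ≤γ a< b< xu yw =
        ≤T-trans (γ-increasing (X-order (reversed< (<K a<)) L<H xu (proj₂ u*))
                               (X<e (s≤s (m≤m+n L L)) (proj₂ u*)))
        (≤T-trans u*≤w* (γ-decreasing (e<Y (<L⇒<H (<N b<)) yw)
                                       (Y-order (<N b<) L<H yw (proj₂ w*))))

    upper-half : γ (proj₁ w*) ≤T γ (proj₁ u*) → Grid W N
    -- Here the higher node comes from `Y`, so `X` and `Y` exchange roles.
    upper-half w*≤u* = Windows.grid 0<N (λ a → Y (suc (L + a))) (λ b → X (suc (L + b))) γ
      (λ a< b< yw xu → adj⇔ (λ { refl → <-irrefl refl (X<Y (upper<H (<N b<)) (upper<H (<K a<)) xu yw) })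
         (λ z z≤w z≤u → common (X<e (upper<e (<N b<)) xu) (e<Y (upper<H (<K a<)) yw) z z≤u z≤w)
         (γ≤γ a< b< yw xu))
      (λ a<a' a'< yw yw' → γ-decreasing (e<Y (upper<H (<K (<-trans a<a' a'<))) yw)
         (Y-order (s≤s (+-monoʳ-< L a<a')) (upper<H (<K a'<)) yw yw'))
      (λ a< b< yw xu → ≤T-trans (γ≤γ a< b< yw xu) (γ≤lo _))
      (λ b<b' b'< → X-order (s≤s (+-monoʳ-< L b<b')) (upper<H (<N b'<)))
      (λ a< b< → ⊎-swap (cell (upper<H (<N b<)) (upper<H (<K a<))))
      where
      <K : ∀ {a} → a < 3 + W * 2 → a < L
      <K a< = <-≤-trans a< K≤L
      <N : ∀ {b} → b < N → b < L
      <N b< = <-≤-trans b< N≤L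
      γ≤γ : ∀ {a b w u} → a < 3 + W * 2 → b < N → Y (suc (L + a)) w → X (suc (L + b)) u →
            γ w ≤T γ u
      γ≤γ a< b< yw xu =
        ≤T-trans (γ-decreasing (e<Y L<H (proj₂ w*))
                               (Y-order (s≤s (m≤m+n L _)) (upper<H (<K a<)) (proj₂ w*) yw))
        (≤T-trans w*≤u* (γ-increasing (X-order (s≤s (m≤m+n L _)) (upper<H (<N b<)) (proj₂ u*) xu)
                                       (X<e (upper<e (<N b<)) xu)))

    grid : Grid W N
    grid with comparable (γ≤p (proj₁ u*)) (γ≤p (proj₁ w*))
    ... | inj₁ u*≤w* = lower-half u*≤w*
    ... | inj₂ w*≤u* = upper-half w*≤u*

-- Intervals of the division and the choice of ordered halves.

≤-increasing : ∀ {k} (f : Fin (suc k) → ℕ) → (∀ a → f (inject₁ a) ≤ f (suc a)) →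
               ∀ {i j} → toℕ i ≤ toℕ j → f i ≤ f j
≤-increasing f step {zero} {zero} _ = ≤-refl
≤-increasing {suc k} f step {zero} {suc j} _ =
  ≤-trans (step zero) (≤-increasing (f ∘ suc) (step ∘ suc) {zero} {j} z≤n)
≤-increasing {suc k} f step {suc i} {suc j} (s≤s i≤j) =
  ≤-increasing (f ∘ suc) (step ∘ suc) {i} {j} i≤j

module IntervalPartitionProperties {r k : ℕ} (P : IntervalPartition r k) where
  open IntervalPartition P

  PartAt : ℕ → Fin r → Set
  PartAt a i = Σ (a < k) λ a<k → InPart (fromℕ< a<k) i

  cut-≤ : ∀ {x y} → toℕ x ≤ toℕ y → cut x ≤ cut y
  cut-≤ = ≤-increasing cut (λ a → <⇒≤ (cut-mono a))

  below-cut : ∀ {a i x} → a < toℕ x → PartAt a i → toℕ i < cut x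
  below-cut {x = x} a<x (a<k , _ , i<) =
    <-≤-trans i< (cut-≤ (subst (_< toℕ x) (sym (toℕ-fromℕ< a<k)) a<x))

  above-cut : ∀ {a i x} → toℕ x ≤ a → PartAt a i → cut x ≤ toℕ i
  above-cut {x = x} x≤a (a<k , i≥ , _) =
    ≤-trans (cut-≤ (subst (toℕ x ≤_) (sym (trans (toℕ-inject₁ _) (toℕ-fromℕ< a<k))) x≤a)) i≥

  PartAt-order : ∀ {a a' i i'} → a < a' → PartAt a i → PartAt a' i' → toℕ i < toℕ i'
  PartAt-order a<a' (a<k , i∈a) i'∈a' =
    <-≤-trans (proj₂ i∈a)
      (above-cut (subst (λ z → suc z ≤ _) (sym (toℕ-fromℕ< a<k)) a<a') i'∈a')

module RankDivision
  {n m : ℕ} {G : SimpleGraph n} (M : TreeModel G m) (minimal : TreeModel.Minimal M)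
  (ρ : Fin m → Fin m) (dfs : TreeModel.IsDFSOrder M ρ)
  (σ : Fin n → Fin n) (order : TreeModel.IsVertexOrder M ρ σ)
  {k : ℕ} (D : Division n n k) (rank : IsRankDivision (adjMatrix G σ) D)
  {W N L H : ℕ} (0<N : 0 < N) (K≤L : 3 + W * 2 ≤ L) (N≤L : N ≤ L)
  (L≤H : 2 + (L + L) ≤ H) (H≤k : 2 * H ≤ k) where
  open DFSOrder M minimal ρ dfs using (Grid)
  open GridExtraction M minimal ρ dfs σ order
  open Division D
  module R = IntervalPartitionProperties rows
  module C = IntervalPartitionProperties cols

  3≤k : 3 ≤ k
  3≤k = ≤-trans K≤L' H≤k
    where
    K≤L' : 3 ≤ 2 * H
    K≤L' = ≤-trans (m≤m+n 3 (W * 2)) (≤-trans K≤L (≤-trans (m≤m+n L L)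
             (≤-trans (≤-trans (m≤n+m (L + L) 2) L≤H) (m≤m+n H _))))

  3→k : Fin 3 → Fin k
  3→k a = inject≤ a 3≤k

  3→k-≢ : ∀ {a b} → a ≢ b → 3→k a ≢ 3→k b
  3→k-≢ a≢b e = a≢b (inject≤-injective 3≤k 3≤k _ _ e)

  cell : ∀ {a b} → a < k → b < k → Cell (R.PartAt a) (C.PartAt b)
  cell a< b< with rank (fromℕ< a<) (fromℕ< b<)
  ... | inj₁ (f , x , distinct) = inj₁ (f ∘ 3→k , (λ a → a< , x (3→k a)) , λ a b a≢b →
        let (j , yj , ≢) = distinct (3→k a) (3→k b) (3→k-≢ a≢b) in j , (b< , yj) , ≢)
  ... | inj₂ (f , y , distinct) = inj₂ (f ∘ 3→k , (λ a → b< , y (3→k a)) , λ a b a≢b →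
        let (i , xi , ≢) = distinct (3→k a) (3→k b) (3→k-≢ a≢b)
        in i , (a< , xi) , λ eq → ≢ (trans (Mx-sym _ _) (trans eq (Mx-sym _ _))))

  H+H≤k : H + H ≤ k
  H+H≤k = ≤-trans (≤-reflexive (cong (H +_) (sym (+-identityʳ H)))) H≤k

  H<1+k : H < suc k
  H<1+k = s≤s (≤-trans (m≤m+n H H) H+H≤k)

  middle : Fin (suc k)
  middle = fromℕ< H<1+k

  toℕ-middle : toℕ middle ≡ H
  toℕ-middle = toℕ-fromℕ< H<1+k

  below : ∀ {a} → a < 2 + (L + L) → a < toℕ middle
  below a< = <-≤-trans a< (≤-trans L≤H (≤-reflexive (sym toℕ-middle)))

  above : ∀ b → toℕ middle ≤ H + b
  above b = ≤-trans (≤-reflexive toℕ-middle) (m≤m+n H b)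

  first<k : ∀ {a} → a < 2 + (L + L) → a < k
  first<k a< = <-≤-trans a< (≤-trans L≤H (≤-trans (m≤m+n H H) H+H≤k))

  second<k : ∀ {b} → b < 2 + (L + L) → H + b < k
  second<k b< = <-≤-trans (+-monoʳ-< H (<-≤-trans b< L≤H)) H+H≤k

  grid : Grid W N
  -- On the side with the earlier middle cut, the first `H` parts precede all parts of index at
  -- least `H` on the other side.
  grid with ≤-total (IntervalPartition.cut rows middle) (IntervalPartition.cut cols middle)
  ... | inj₁ r≤c = Separated.grid 0<N K≤L N≤L R.PartAt (λ b → C.PartAt (H + b))
        (λ a<a' _ → R.PartAt-order a<a')
        (λ b<b' _ → C.PartAt-order (+-monoʳ-< H b<b'))
        (λ {_} {b} a< _ xi yj → <-≤-trans (R.below-cut (below a<) xi)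
                                  (≤-trans r≤c (C.above-cut (above b) yj)))
        (λ a< b< → cell (first<k a<) (second<k b<))
  ... | inj₂ c≤r = Separated.grid 0<N K≤L N≤L C.PartAt (λ b → R.PartAt (H + b))
        (λ a<a' _ → C.PartAt-order a<a')
        (λ b<b' _ → R.PartAt-order (+-monoʳ-< H b<b'))
        (λ {_} {b} a< _ xi yj → <-≤-trans (C.below-cut (below a<) xi)
                                  (≤-trans c≤r (R.above-cut (above b) yj)))
        (λ a< b< → ⊎-swap (cell (second<k b<) (first<k a<)))

-- Comparison of the numbers of parts with `g`.

siblingBound-2^ : ∀ k → 2 + siblingBound k ≡ 2 ^ suc k
siblingBound-2^ zero    = refl
siblingBound-2^ (suc k) = begin-equality
  4 + (S + S)        ≡⟨ cong (2 +_) (sym (trans (+-suc S (suc S)) (cong suc (+-suc S S)))) ⟩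
  (2 + S) + (2 + S)  ≡⟨ cong₂ _+_ IH (trans IH (sym (+-identityʳ _))) ⟩
  2 ^ suc (suc k)    ∎
  where
  open ≤-Reasoning
  S  = siblingBound k
  IH = siblingBound-2^ k

-- Adding `7` lets the product `(7 + S) * (7 + F)` dominate the recursion, so induction yields a
-- power.
descentBound-upper : ∀ {D y} → 7 + siblingBound D ≤ y →
                     ∀ k → 7 + descentBound D k ≤ 7 * y ^ k
descentBound-upper {D} {y} S≤y zero = ≤-refl
descentBound-upper {D} {y} S≤y (suc k) = begin
  7 + (4 + S * (3 + F))    ≤⟨ m≤n+m _ (4 * S + 38 + 7 * F) ⟩
  (4 * S + 38 + 7 * F) + (11 + S * (3 + F))
                           ≡⟨ expand S F ⟩
  (7 + S) * (7 + F)        ≤⟨ *-mono-≤ S≤y (descentBound-upper S≤y k) ⟩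
  y * (7 * y ^ k)          ≡⟨ x∙yz≈y∙xz y 7 (y ^ k) ⟩
  7 * y ^ suc k            ∎
  where
  open ≤-Reasoning
  S = siblingBound D
  F = descentBound D k
  expand : ∀ S F → (4 * S + 38 + 7 * F) + (11 + S * (3 + F)) ≡ (7 + S) * (7 + F)
  expand = solve 2 (λ S F → (con 4 :* S :+ con 38 :+ con 7 :* F) :+ (con 11 :+ S :* (con 3 :+ F))
                             := (con 7 :+ S) :* (con 7 :+ F)) refl
    where open +-*-Solver

-- Linear growth fits the parts consumed by the `D + D` windows into those provided for the descent.
descentBound-lower : ∀ {D} → 1 ≤ siblingBound D → ∀ k → 7 * k ≤ descentBound D k
descentBound-lower {D} 1≤S zero = z≤n
descentBound-lower {D} 1≤S (suc k) = begin
  7 * suc k                     ≡⟨ *-suc 7 k ⟩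
  7 + 7 * k                     ≤⟨ +-monoʳ-≤ 7 (descentBound-lower 1≤S k) ⟩
  7 + descentBound D k          ≡⟨ cong (4 +_) (sym (*-identityˡ (3 + descentBound D k))) ⟩
  4 + 1 * (3 + descentBound D k) ≤⟨ +-monoʳ-≤ 4 (*-monoˡ-≤ (3 + descentBound D k) 1≤S) ⟩
  descentBound D (suc k)        ∎
  where open ≤-Reasoning

module Bounds (t : ℕ) (0<D : 0 < t * t) where
  open ≤-Reasoning

  D Q y S L : ℕ
  D = t * t
  Q = 2 * D
  y = g₁ t
  S = siblingBound D
  L = descentBound D D

  2≤Q : 2 ≤ Q
  2≤Q = *-monoʳ-≤ 2 0<D

  2^Q≤Q^Q : 2 ^ Q ≤ Q ^ Q
  2^Q≤Q^Q = ^-monoˡ-≤ Q 2≤Q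

  6≤y : 6 ≤ y
  6≤y = ≤-trans (+-monoˡ-≤ 2 (^-monoʳ-≤ 2 2≤Q)) (+-monoˡ-≤ 2 2^Q≤Q^Q)

  4+S≤y : 4 + S ≤ y
  4+S≤y = begin
    2 + (2 + S)      ≡⟨ cong (2 +_) (siblingBound-2^ D) ⟩
    2 + 2 ^ suc D    ≤⟨ +-monoʳ-≤ 2 (^-monoʳ-≤ 2 1+D≤Q) ⟩
    2 + 2 ^ Q        ≤⟨ +-monoʳ-≤ 2 2^Q≤Q^Q ⟩
    2 + Q ^ Q        ≡⟨ +-comm 2 (Q ^ Q) ⟩
    y                ∎
    where
    1+D≤Q : 1 + D ≤ Q
    1+D≤Q = +-mono-≤ 0<D (m≤m+n D 0)

  -- The base of the power must exceed `S` by `7`. Squaring `y` achieves this and doubles the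
  -- exponent, for which `g₂` has room.
  7+S≤y² : 7 + S ≤ y * y
  7+S≤y² = begin
    3 + (4 + S)  ≤⟨ +-mono-≤ (≤-trans (m≤m+n 3 3) 6≤y) 4+S≤y ⟩
    y + y        ≡⟨ cong (y +_) (sym (+-identityʳ y)) ⟩
    2 * y        ≤⟨ *-monoˡ-≤ y (≤-trans (m≤m+n 2 4) 6≤y) ⟩
    y * y        ∎

  1≤S : 1 ≤ S
  1≤S = positive 0<D
    where
    positive : ∀ {k} → 0 < k → 1 ≤ siblingBound k
    positive {suc k} _ = s≤s z≤n

  windows≤L : 3 + (D + D) * 2 ≤ L
  windows≤L = begin
    3 + (D + D) * 2      ≤⟨ +-monoˡ-≤ _ (*-monoʳ-≤ 3 0<D) ⟩
    3 * D + (D + D) * 2  ≡⟨ solve 1 (λ D → con 3 :* D :+ (D :+ D) :* con 2 := con 7 :* D) refl D ⟩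
    7 * D                ≤⟨ descentBound-lower 1≤S D ⟩
    L                    ∎
    where open +-*-Solver

  0<L : 0 < L
  0<L = ≤-trans (s≤s z≤n) windows≤L

  instance
    y-nonZero : NonZero y
    y-nonZero = >-nonZero (≤-trans (s≤s z≤n) 6≤y)

  parts≤g : 2 + (L + L) ≤ g t
  parts≤g = begin
    2 + (L + L)              ≤⟨ +-mono-≤ (m≤m+n 2 12) (≤-refl {L + L}) ⟩
    14 + (L + L)             ≡⟨ solve 1 (λ L → con 14 :+ (L :+ L) := con 2 :* (con 7 :+ L)) refl L ⟩
    2 * (7 + L)              ≤⟨ *-monoʳ-≤ 2 (descentBound-upper 7+S≤y² D) ⟩
    -- One extra factor `y` absorbs the constant, as `7 ≤ 2 * y`.
    2 * (7 * (y * y) ^ D)    ≤⟨ *-monoʳ-≤ 2 (*-monoˡ-≤ ((y * y) ^ D) (≤-trans (m≤m+n 7 5) (*-monoʳ-≤ 2 6≤y))) ⟩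
    2 * (2 * y * (y * y) ^ D) ≡⟨ solve 2 (λ y z → con 2 :* (con 2 :* y :* z) := con 4 :* (y :* z)) refl y ((y * y) ^ D) ⟩
    4 * (y * (y * y) ^ D)    ≡⟨ cong (λ z → 4 * (y * z)) (trans (cong (λ x → (y * x) ^ D) (sym (*-identityʳ y))) (^-*-assoc y 2 D)) ⟩
    4 * y ^ suc Q            ≤⟨ *-monoʳ-≤ 4 (^-monoʳ-≤ y 1+Q≤g₂) ⟩
    g t                      ∎
    where
    open +-*-Solver
    1+Q≤g₂ : suc Q ≤ g₂ t
    1+Q≤g₂ = begin
      suc Q          ≡⟨ +-comm 1 Q ⟩
      Q + 1          ≤⟨ +-monoˡ-≤ 1 (m≤m*n Q (Q * 1) {{>-nonZero (subst (0 <_) (sym (*-identityʳ Q)) (≤-trans (s≤s z≤n) 2≤Q))}}) ⟩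
      Q ^ 2 + 1      ∎

-- The degenerate case `t = 0` and the conclusion.

emptyGTP : ∀ {n} (G : SimpleGraph n) ℓ → SemiInducedGTP G 0 ℓ
emptyGTP G ℓ = record
  { vtx = λ { (A () _) ; (B _ () _) ; (C () _) }
  ; inj = λ { {A () _} ; {B _ () _} ; {C () _} }
  ; adjAB = λ () ; adjBB = λ _ () ; adjBC = λ () }

theorem3p7 : ∀ (t n m : ℕ) (G : SimpleGraph n) (M : TreeModel G m) →
    TreeModel.Minimal M →
    ∀ (ρ : Fin m → Fin m) → TreeModel.IsDFSOrder M ρ →
    ∀ (σ : Fin n → Fin n) → TreeModel.IsVertexOrder M ρ σ →
    GridRankAtLeast (adjMatrix G σ) (2 * g t) →
    SemiInducedGTP G t 0 ⊎ SemiInducedGTP G t 2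
theorem3p7 zero n m G M minimal ρ dfs σ order rank = inj₁ (emptyGTP G 0)
theorem3p7 t@(suc _) n m G M minimal ρ dfs σ order (k , 2g≤k , division , rank) =
  -- All `L` parts of the grid lie below `base`, so the descent starts there with part `0`.
  finish (descend (λ i → toℕ<D+D _) (t * t) pathColumn (λ i → toℕ<D+D _) base
            here 0 (≤-reflexive (+-identityʳ L))
            λ {a} {b} a< _ b< → base≤low a< (subst (b <_) (+-identityʳ L) b<))
  where
  open Bounds t (s≤s z≤n)
  grid = RankDivision.grid M minimal ρ dfs σ order division rank 0<L windows≤L ≤-refl parts≤g 2g≤k
  open DFSOrder M minimal ρ dfs using (module Grid)
  open Grid grid using (base; base≤low)
  open Descent M minimal ρ dfs (s≤s z≤n) 0<L grid
  open TransversalPairs M minimal ρ dfs t (s≤s z≤n) 0<L grid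

  finish : SiblingPattern siblingColumn ⊎ PathPattern (t * t) pathColumn base →
           SemiInducedGTP G t 0 ⊎ SemiInducedGTP G t 2
  finish (inj₁ siblings) = inj₂ (fromSiblings siblings)
  finish (inj₂ path)     = inj₁ (fromPath path)
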